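{- Let $f(z)\in\mathbb{Q}[[z]]$ be a delta series with compositional inverse $g(z)$, and let $C^f_m$ be the operators on $\Lambda$ determined by $\sum_m (-1)^m C^f_m z^m = U_f\circ C(z)\circ U_g$. For each partition $\lambda$, with conjugate $\lambda'=(\lambda'_1,\dots,\lambda'_m)$, set $$P_\lambda(X)=C^f_{\lambda'_1}\circ C^f_{\lambda'_2}\circ\cdots\circ C^f_{\lambda'_m}[1].$$ Then the (in general non-homogeneous) basis $\{P_\lambda(X)\}$ of the ring of symmetric functions $\Lambda$ is of Littlewood--Richardson type, that is, for every partition $\lambda$, $$P_\lambda(X+X')=\sum_{\mu,\nu}c^{\lambda}_{\mu\nu}\,P_\mu(X)\,P_\nu(X').$$
   Context: $\Lambda$ is the ring of symmetric functions over $\mathbb{Q}$ in infinitely many variables $X=\{x_1,x_2,\dots\}$, with complete symmetric functions $h_n(X)$, elementary symmetric functions $e_n(X)$ and Schur functions $s_\lambda(X)$. $F(X+X')$ denotes $F$ evaluated on the disjoint union of the alphabets $X$ and $X'$; for a single variable $u$, $F(X+u)$ denotes $F$ evaluated on the alphabet $X$ with the variable $u$ adjoined. The Littlewood--Richardson numbers $c^\lambda_{\mu\nu}$ are defined by $s_\lambda(X+X')=\sum_{\mu,\nu}c^\lambda_{\mu\nu}s_\mu(X)s_\nu(X')$ (equivalently $s_\mu s_\nu=\sum_\lambda c^\lambda_{\mu\nu}s_\lambda$). A delta series is a formal power series that is invertible with respect to composition (zero constant term, nonzero linear coefficient); its compositional inverse $g$ satisfies $f(g(z))=g(f(z))=z$.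 For a delta series $f$ define $r_n(X)\in\Lambda$ by $\prod_{x\in X}\frac{1}{1-f(z)x}=\sum_{n\ge0}r_n(X)z^n$. The umbral operator $U_f:\Lambda\to\Lambda$ is the $\mathbb{Q}$-algebra homomorphism with $U_f[h_n(X)]=r_n(X)$ for all $n$; $U_g$ is defined in the same way from $g$, and $U_f^{ -1}=U_g$. The column operator for Schur functions is $C(z)=\sum_{m\in\mathbb{Z}}(-1)^mC_mz^m=\mathcal{P}(-z)\,\mathcal{T}(1/z)$, where $\mathcal{P}(-z)$ is multiplication by $\prod_{x\in X}(1-xz)$ and $\mathcal{T}(u)[F(X)]=F(X+u)$. Explicitly, $C_m=\sum_{k\ge0}(-1)^k e_{m+k}(X)\,\partial_{h_k}$, where $\partial_{h_k}$ is the adjoint, with respect to the Hall inner product, of multiplication by $h_k$. Consequently $C^f_m=U_f\circ C_m\circ U_g$. -}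

module Defs where

open import Algebra.Bundles using (RawRing; CommutativeMonoid)
open import Algebra.Morphism.Structures using (IsRingHomomorphism)
open import Data.Integer.Base as ℤ using (ℤ; -[1+_])
open import Data.List.Base
  using (List; []; _∷_; _++_; _∷ʳ_; map; foldr; reverse; filter; length; upTo; applyUpTo;
         cartesianProductWith)
open import Data.List.Membership.Propositional using (_∈_)
open import Data.List.Relation.Binary.Permutation.Propositional
  using (_↭_; refl; prep; swap; ↭-sym) renaming (trans to ↭trans)
open import Data.List.Relation.Binary.Permutation.Propositional.Properties
  using (All-resp-↭)
open import Data.List.Relation.Unary.All using (All; []; _∷_; all?)
import Data.List.Relation.Unary.All.Properties as All
open import Data.List.Relation.Unary.Linked using (Linked)
open import Data.List.Relation.Unary.Unique.Propositional using (Unique)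
open import Data.Nat.Base as ℕ using (ℕ; zero; suc; _≤_; _<_; _≥_; _∸_; z≤n; s≤s)
open import Data.Nat.ListAction using (sum)
open import Data.Nat.ListAction.Properties using (sum-++; sum-↭)
import Data.Nat.Properties as ℕ
open import Data.Product.Base using (Σ-syntax; ∃-syntax; _×_; _,_; proj₁; proj₂)
open import Data.Rational.Base using (ℚ; 0ℚ; 1ℚ; _+_; _*_; -_)
import Data.Rational.Properties as ℚ
open import Data.Sum.Base using (inj₁; inj₂)
open import Function.Base using (_∘_)
open import Level using (0ℓ)
open import Relation.Binary.PropositionalEquality
  using (_≡_; _≢_; _≗_; refl; sym; trans; cong; cong₂; subst; module ≡-Reasoning)
open import Relation.Nullary.Decidable.Core using (Dec; yes; no)
open import Relation.Nullary.Negation.Core using (contradiction)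

open import Algebra.Properties.CommutativeSemigroup
  (CommutativeMonoid.commutativeSemigroup ℚ.+-0-commutativeMonoid)
  using (interchange)
open import Algebra.Properties.CommutativeSemigroup
  (CommutativeMonoid.commutativeSemigroup ℚ.*-1-commutativeMonoid)
  using () renaming (x∙yz≈y∙xz to *-leftComm)

∑ : {A : Set} → List A → (A → ℚ) → ℚ
∑ xs t = foldr (λ x s → t x + s) 0ℚ xs

-- ⨁ n t is the sum of t i j over all i + j = n.
⨁ : ℕ → (ℕ → ℕ → ℚ) → ℚ
⨁ zero    t = t 0 0
⨁ (suc n) t = t 0 (suc n) + ⨁ n (λ i j → t (suc i) j)

⟦_⟧ : {A : Set} → Dec A → ℚ
⟦ yes _ ⟧ = 1ℚ
⟦ no  _ ⟧ = 0ℚ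

⟦⟧-cong : {A B : Set} (a? : Dec A) (b? : Dec B) → (A → B) → (B → A) → ⟦ a? ⟧ ≡ ⟦ b? ⟧
⟦⟧-cong (yes a) (yes b) f g = refl
⟦⟧-cong (yes a) (no ¬b) f g = contradiction (f a) ¬b
⟦⟧-cong (no ¬a) (yes b) f g = contradiction (g b) ¬a
⟦⟧-cong (no ¬a) (no ¬b) f g = refl

⟦⟧-no : {A : Set} (a? : Dec A) → (A → 0ℚ ≡ 1ℚ) → ⟦ a? ⟧ ≡ 0ℚ
⟦⟧-no (yes a) f = sym (f a)
⟦⟧-no (no ¬a) f = refl

⨁-cong : ∀ n {s t : ℕ → ℕ → ℚ} → (∀ i j → s i j ≡ t i j) → ⨁ n s ≡ ⨁ n t
⨁-cong zero    e = e 0 0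
⨁-cong (suc n) e = cong₂ _+_ (e 0 (suc n)) (⨁-cong n (λ i j → e (suc i) j))

⨁-zero : ∀ n {t : ℕ → ℕ → ℚ} → (∀ i j → i ℕ.+ j ≡ n → t i j ≡ 0ℚ) → ⨁ n t ≡ 0ℚ
⨁-zero zero    e = e 0 0 refl
⨁-zero (suc n) e = trans
  (cong₂ _+_ (e 0 (suc n) refl) (⨁-zero n (λ i j p → e (suc i) j (cong suc p))))
  (ℚ.+-identityˡ 0ℚ)

⨁-+ : ∀ n (s t : ℕ → ℕ → ℚ) → ⨁ n (λ i j → s i j + t i j) ≡ ⨁ n s + ⨁ n t
⨁-+ zero    s t = refl
⨁-+ (suc n) s t = trans
  (cong (λ q → (s 0 (suc n) + t 0 (suc n)) + q)
    (⨁-+ n (λ i → s (suc i)) (λ i → t (suc i))))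
  (interchange (s 0 (suc n)) (t 0 (suc n))
    (⨁ n (λ i → s (suc i))) (⨁ n (λ i → t (suc i))))

⨁-* : ∀ n (q : ℚ) (t : ℕ → ℕ → ℚ) → q * ⨁ n t ≡ ⨁ n (λ i j → q * t i j)
⨁-* zero    q t = refl
⨁-* (suc n) q t = trans
  (ℚ.*-distribˡ-+ q (t 0 (suc n)) (⨁ n (λ i → t (suc i))))
  (cong (λ u → q * t 0 (suc n) + u) (⨁-* n q (λ i → t (suc i))))

⨁-comm : ∀ m n (t : ℕ → ℕ → ℕ → ℕ → ℚ) →
         ⨁ m (λ i j → ⨁ n (λ k l → t i j k l)) ≡ ⨁ n (λ k l → ⨁ m (λ i j → t i j k l))
⨁-comm zero    n t = refl
⨁-comm (suc m) n t = trans
  (cong (λ q → ⨁ n (t 0 (suc m)) + q) (⨁-comm m n (λ i → t (suc i))))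
  (sym (⨁-+ n (t 0 (suc m)) (λ k l → ⨁ m (λ i j → t (suc i) j k l))))

⨁-assoc-suc : ∀ n (t : ℕ → ℕ → ℕ → ℚ) →
  ⨁ (suc n) (λ i j → ⨁ j (t i)) ≡
  ⨁ (suc n) (λ i l → t i 0 l) + ⨁ n (λ i j → ⨁ j (λ k l → t i (suc k) l))
⨁-assoc-suc zero    t = begin
  (t 0 0 1 + t 0 1 0) + t 1 0 0  ≡⟨ ℚ.+-assoc (t 0 0 1) (t 0 1 0) (t 1 0 0) ⟩
  t 0 0 1 + (t 0 1 0 + t 1 0 0)  ≡⟨ cong (λ q → t 0 0 1 + q) (ℚ.+-comm (t 0 1 0) (t 1 0 0)) ⟩
  t 0 0 1 + (t 1 0 0 + t 0 1 0)  ≡⟨ ℚ.+-assoc (t 0 0 1) (t 1 0 0) (t 0 1 0) ⟨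
  (t 0 0 1 + t 1 0 0) + t 0 1 0  ∎
  where open ≡-Reasoning
⨁-assoc-suc (suc n) t = trans
  (cong (λ q → ⨁ (suc (suc n)) (t 0) + q) (⨁-assoc-suc n (λ i → t (suc i))))
  (interchange (t 0 0 (suc (suc n))) (⨁ (suc n) (λ k → t 0 (suc k)))
    (⨁ (suc n) (λ i → t (suc i) 0))
    (⨁ n (λ i j → ⨁ j (λ k → t (suc i) (suc k)))))

⨁-leftComm : ∀ n (t : ℕ → ℕ → ℕ → ℚ) →
  ⨁ n (λ i j → ⨁ j (λ k l → t i k l)) ≡ ⨁ n (λ k j → ⨁ j (λ i l → t i k l))
⨁-leftComm zero    t = refl
⨁-leftComm (suc n) t = trans
  (⨁-assoc-suc n t)
  (cong (λ q → ⨁ (suc n) (λ i → t i 0) + q)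
    (⨁-leftComm n (λ i k l → t i (suc k) l)))

-- A formal power series in x₁, x₂, …: the monomial x₁^a₁ ⋯ xₙ^aₙ is the
-- list a₁ ∷ ⋯ ∷ aₙ ∷ [] of its exponents, up to trailing zeros.
Series : Set
Series = List ℕ → ℚ

record Λ : Set where
  field
    coeff     : Series
    symmetric : ∀ {α β} → α ↭ β → coeff α ≡ coeff β
    stable    : ∀ α → coeff (α ∷ʳ 0) ≡ coeff α
    degree    : ℕ
    bounded   : ∀ α → degree < sum α → coeff α ≡ 0ℚ

open Λ public

infix 4 _≈_
_≈_ : Λ → Λ → Set
F ≈ G = coeff F ≗ coeff G

-- The coefficient of a monomial in F · G is the sum, over all ways of
-- splitting its exponents as componentwise sums, of the products of the
-- coefficients.
infixl 7 _⊛_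
_⊛_ : Series → Series → Series
(F ⊛ G) []      = F [] * G []
(F ⊛ G) (a ∷ α) = ⨁ a (λ i j → ((F ∘ (i ∷_)) ⊛ (G ∘ (j ∷_))) α)

⊛-cong : ∀ {F F′ G G′ : Series} → F ≗ F′ → G ≗ G′ → F ⊛ G ≗ F′ ⊛ G′
⊛-cong p q []      = cong₂ _*_ (p []) (q [])
⊛-cong p q (a ∷ α) = ⨁-cong a (λ i j → ⊛-cong (p ∘ (i ∷_)) (q ∘ (j ∷_)) α)

⊛-symmetric : ∀ (F G : Series) →
              (∀ {α β} → α ↭ β → F α ≡ F β) → (∀ {α β} → α ↭ β → G α ≡ G β) →
              ∀ {α β} → α ↭ β → (F ⊛ G) α ≡ (F ⊛ G) β
⊛-symmetric F G p q refl = refl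
⊛-symmetric F G p q (prep a r) = ⨁-cong a λ i j →
  ⊛-symmetric (F ∘ (i ∷_)) (G ∘ (j ∷_)) (p ∘ prep i) (q ∘ prep j) r
⊛-symmetric F G p q {_ ∷ _ ∷ α} {_ ∷ _ ∷ β} (swap a b r) = trans
  (⨁-comm a b (λ i j k l → ((F ∘ (i ∷_) ∘ (k ∷_)) ⊛ (G ∘ (j ∷_) ∘ (l ∷_))) α))
  (⨁-cong b λ k l → ⨁-cong a λ i j → trans
    (⊛-cong (λ γ → p (swap i k refl)) (λ γ → q (swap j l refl)) α)
    (⊛-symmetric (F ∘ (k ∷_) ∘ (i ∷_)) (G ∘ (l ∷_) ∘ (j ∷_))
      (p ∘ prep k ∘ prep i) (q ∘ prep l ∘ prep j) r))
⊛-symmetric F G p q (↭trans r s) =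
  trans (⊛-symmetric F G p q r) (⊛-symmetric F G p q s)

⊛-stable : ∀ (F G : Series) →
           (∀ α → F (α ∷ʳ 0) ≡ F α) → (∀ α → G (α ∷ʳ 0) ≡ G α) →
           ∀ α → (F ⊛ G) (α ∷ʳ 0) ≡ (F ⊛ G) α
⊛-stable F G p q []      = cong₂ _*_ (p []) (q [])
⊛-stable F G p q (a ∷ α) = ⨁-cong a λ i j →
  ⊛-stable (F ∘ (i ∷_)) (G ∘ (j ∷_)) (p ∘ (i ∷_)) (q ∘ (j ∷_)) α

-- An inequality d + e < m + n forces d < m or e < n; the offsets m, n
-- collect the exponents already split off.
⊛-bounded : ∀ (F G : Series) d e m n →
            (∀ α → d < m ℕ.+ sum α → F α ≡ 0ℚ) → (∀ α → e < n ℕ.+ sum α → G α ≡ 0ℚ) →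
            ∀ α → d ℕ.+ e < (m ℕ.+ n) ℕ.+ sum α → (F ⊛ G) α ≡ 0ℚ
⊛-bounded F G d e m n p q [] lt with ℕ.≤-<-connex m d
... | inj₂ d<m = trans
  (cong (_* G []) (p [] (ℕ.<-≤-trans d<m (ℕ.m≤m+n m 0)))) (ℚ.*-zeroˡ (G []))
... | inj₁ m≤d = trans (cong (F [] *_) (q [] e<n)) (ℚ.*-zeroʳ (F []))
  where
  e<n : e < n ℕ.+ 0
  e<n = ℕ.+-cancelˡ-< d e (n ℕ.+ 0) (ℕ.<-≤-trans lt (ℕ.≤-trans
    (ℕ.≤-reflexive (ℕ.+-assoc m n 0)) (ℕ.+-monoˡ-≤ (n ℕ.+ 0) m≤d)))
⊛-bounded F G d e m n p q (a ∷ α) lt = ⨁-zero a λ i j i+j≡a →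
  ⊛-bounded (F ∘ (i ∷_)) (G ∘ (j ∷_)) d e (m ℕ.+ i) (n ℕ.+ j)
    (λ γ l → p (i ∷ γ) (subst (d <_) (ℕ.+-assoc m i (sum γ)) l))
    (λ γ l → q (j ∷ γ) (subst (e <_) (ℕ.+-assoc n j (sum γ)) l))
    α (subst (d ℕ.+ e <_) (offsets i j i+j≡a) lt)
  where
  offsets : ∀ i j → i ℕ.+ j ≡ a →
            (m ℕ.+ n) ℕ.+ (a ℕ.+ sum α) ≡ ((m ℕ.+ i) ℕ.+ (n ℕ.+ j)) ℕ.+ sum α
  offsets i j refl = trans
    (sym (ℕ.+-assoc (m ℕ.+ n) (i ℕ.+ j) (sum α)))
    (cong (ℕ._+ sum α) (ℕ-interchange m n i j))
    where
    open import Algebra.Properties.CommutativeSemigroup ℕ.+-commutativeSemigroup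
      using () renaming (interchange to ℕ-interchange)

0Λ : Λ
0Λ = record
  { coeff     = λ _ → 0ℚ
  ; symmetric = λ _ → refl
  ; stable    = λ _ → refl
  ; degree    = 0
  ; bounded   = λ _ _ → refl
  }

infixl 6 _+Λ_
_+Λ_ : Λ → Λ → Λ
F +Λ G = record
  { coeff     = λ α → coeff F α + coeff G α
  ; symmetric = λ r → cong₂ _+_ (symmetric F r) (symmetric G r)
  ; stable    = λ α → cong₂ _+_ (stable F α) (stable G α)
  ; degree    = degree F ℕ.⊔ degree G
  ; bounded   = λ α lt → trans
      (cong₂ _+_
        (bounded F α (ℕ.≤-<-trans (ℕ.m≤m⊔n (degree F) (degree G)) lt))
        (bounded G α (ℕ.≤-<-trans (ℕ.m≤n⊔m (degree F) (degree G)) lt)))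
      (ℚ.+-identityˡ 0ℚ)
  }

infixl 7 _*Λ_
_*Λ_ : Λ → Λ → Λ
F *Λ G = record
  { coeff     = coeff F ⊛ coeff G
  ; symmetric = ⊛-symmetric (coeff F) (coeff G) (symmetric F) (symmetric G)
  ; stable    = ⊛-stable (coeff F) (coeff G) (stable F) (stable G)
  ; degree    = degree F ℕ.+ degree G
  ; bounded   = ⊛-bounded (coeff F) (coeff G) (degree F) (degree G) 0 0 (bounded F) (bounded G)
  }

infixr 7 _•_
_•_ : ℚ → Λ → Λ
q • F = record
  { coeff     = λ α → q * coeff F α
  ; symmetric = λ r → cong (q *_) (symmetric F r)
  ; stable    = λ α → cong (q *_) (stable F α)
  ; degree    = degree F
  ; bounded   = λ α lt → trans (cong (q *_) (bounded F α lt)) (ℚ.*-zeroʳ q)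
  }

sum-∷ʳ0 : ∀ α → sum (α ∷ʳ 0) ≡ sum α
sum-∷ʳ0 α = trans (sum-++ α (0 ∷ [])) (ℕ.+-identityʳ (sum α))

h : ℕ → Λ
h n = record
  { coeff     = λ α → ⟦ sum α ℕ.≟ n ⟧
  ; symmetric = λ {α} {β} r → cong (λ k → ⟦ k ℕ.≟ n ⟧) (sum-↭ r)
  ; stable    = λ α → cong (λ k → ⟦ k ℕ.≟ n ⟧) (sum-∷ʳ0 α)
  ; degree    = n
  ; bounded   = λ α lt → ⟦⟧-no (sum α ℕ.≟ n) (λ eq → contradiction (sym eq) (ℕ.<⇒≢ lt))
  }

squarefree? : ∀ α → Dec (All (_≤ 1) α)
squarefree? = all? (ℕ._≤? 1)

e : ℕ → Λ
e n = record
  { coeff     = λ α → ⟦ squarefree? α ⟧ * ⟦ sum α ℕ.≟ n ⟧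
  ; symmetric = λ {α} {β} r → cong₂ _*_
      (⟦⟧-cong (squarefree? α) (squarefree? β) (All-resp-↭ r) (All-resp-↭ (↭-sym r)))
      (symmetric (h n) r)
  ; stable    = λ α → cong₂ _*_
      (⟦⟧-cong (squarefree? (α ∷ʳ 0)) (squarefree? α)
        (λ ps → proj₁ (All.∷ʳ⁻ ps)) (λ ps → All.∷ʳ⁺ ps z≤n))
      (stable (h n) α)
  ; degree    = n
  ; bounded   = λ α lt → trans
      (cong (⟦ squarefree? α ⟧ *_) (bounded (h n) α lt)) (ℚ.*-zeroʳ ⟦ squarefree? α ⟧)
  }

1Λ : Λ
1Λ = h 0

Λ-rawRing : RawRing 0ℓ 0ℓ
Λ-rawRing = record
  { Carrier = Λ
  ; _≈_     = _≈_
  ; _+_     = _+Λ_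
  ; _*_     = _*Λ_
  ; -_      = (- 1ℚ) •_
  ; 0#      = 0Λ
  ; 1#      = 1Λ
  }

∑Λ : {A : Set} → List A → (A → Λ) → Λ
∑Λ xs t = foldr (λ x F → t x +Λ F) 0Λ xs

-- Coefficient of x^α x′^β in F(X + X′), and of u^k in F(X + u).  A
-- symmetric function may be evaluated on any listing of its alphabet;
-- here the variables X precede X′, and u precedes X.
_[X+X′] : Series → List ℕ → List ℕ → ℚ
(F [X+X′]) α β = F (α ++ β)

𝒯 : ℕ → Λ → Λ
𝒯 k F = record
  { coeff     = λ α → coeff F (k ∷ α)
  ; symmetric = λ r → symmetric F (prep k r)
  ; stable    = λ α → stable F (k ∷ α)
  ; degree    = degree F
  ; bounded   = λ α lt → bounded F (k ∷ α) (ℕ.<-≤-trans lt (ℕ.m≤n+m (sum α) k))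
  }

record Partition : Set where
  field
    parts      : List ℕ
    decreasing : Linked _≥_ parts
    positive   : All (0 <_) parts

open Partition public

first : List ℕ → ℕ
first []      = 0
first (l ∷ _) = l

-- λ′ⱼ₊₁ is the number of i with λᵢ > j, for 0 ≤ j < λ₁.
conjugate : Partition → List ℕ
conjugate p = applyUpTo (λ j → length (filter (j ℕ.<?_) (parts p))) (first (parts p))

-- All μ such that λ/μ is a horizontal strip: λ₁ ≥ μ₁ ≥ λ₂ ≥ μ₂ ≥ ⋯ ≥ λₗ ≥ μₗ ≥ 0,
-- where μ is listed with the same number of (possibly zero) parts as λ.
strips : List ℕ → List (List ℕ)
strips []       = [] ∷ []
strips (l ∷ ls) = cartesianProductWith _∷_ (interval (first ls) l) (strips ls)
  where
  interval : ℕ → ℕ → List ℕ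
  interval lo hi = map (lo ℕ.+_) (upTo (suc hi ∸ lo))

-- The number of semistandard tableaux of shape λ in which the letters
-- n, n-1, …, 1 occur aₙ, …, a₁ times.  The tableau T is encoded by the chain
-- λ = λ⁽ⁿ⁾ ⊇ ⋯ ⊇ λ⁽⁰⁾ = ∅, where λ⁽ⁱ⁾ is the shape of the letters ≤ i of T;
-- T is semistandard exactly if every λ⁽ⁱ⁾/λ⁽ⁱ⁻¹⁾ is a horizontal strip.
tableaux : (weight : List ℕ) (shape : List ℕ) → ℚ
tableaux []      l = ⟦ sum l ℕ.≟ 0 ⟧
tableaux (a ∷ w) l = ∑ (strips l) (λ m → ⟦ sum m ℕ.+ a ℕ.≟ sum l ⟧ * tableaux w m)

-- s_λ is the sum of x^T over all semistandard tableaux T of shape λ.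
s : Partition → Series
s p α = tableaux (reverse α) (parts p)

Power : Set
Power = ℕ → ℚ

infixl 7 _·_
_·_ : Power → Power → Power
(p · q) n = ⨁ n (λ i j → p i * q j)

1ᵖ : Power
1ᵖ zero    = 1ℚ
1ᵖ (suc _) = 0ℚ

z : Power
z (suc zero) = 1ℚ
z _          = 0ℚ

infixr 8 _^_
_^_ : Power → ℕ → Power
p ^ zero  = 1ᵖ
p ^ suc k = p · p ^ k

record DeltaSeries : Set where
  field
    series   : Power
    constant : series 0 ≡ 0ℚ
    linear   : series 1 ≢ 0ℚ

open DeltaSeries public

-- f(g(z)); as g has no constant term, only the terms f_k g^k with k ≤ n
-- contribute to the coefficient of z^n.
infixr 9 _⟪_⟫
_⟪_⟫ : DeltaSeries → DeltaSeries → Power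
(f ⟪ g ⟫) n = ∑ (upTo (suc n)) (λ k → series f k * (series g ^ k) n)

IsCompositionalInverse : DeltaSeries → DeltaSeries → Set
IsCompositionalInverse f g = (f ⟪ g ⟫ ≗ z) × (g ⟪ f ⟫ ≗ z)

-- The coefficient, a power series in z, of x₁^a₁ ⋯ xₙ^aₙ in
-- ∏ₓ 1/(1 - f(z)x) = ∏ₓ (1 + f(z)x + f(z)²x² + ⋯).
generating : Power → List ℕ → Power
generating f α = foldr (λ a p → f ^ a · p) 1ᵖ α

·-cong : ∀ {p p′ q q′ : Power} → p ≗ p′ → q ≗ q′ → p · q ≗ p′ · q′
·-cong e₁ e₂ n = ⨁-cong n (λ i j → cong₂ _*_ (e₁ i) (e₂ j))

·-leftComm : ∀ (p q u : Power) → p · (q · u) ≗ q · (p · u)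
·-leftComm p q u n = begin
  ⨁ n (λ i j → p i * ⨁ j (λ k l → q k * u l))
    ≡⟨ ⨁-cong n (λ i j → ⨁-* j (p i) _) ⟩
  ⨁ n (λ i j → ⨁ j (λ k l → p i * (q k * u l)))
    ≡⟨ ⨁-leftComm n (λ i k l → p i * (q k * u l)) ⟩
  ⨁ n (λ k j → ⨁ j (λ i l → p i * (q k * u l)))
    ≡⟨ ⨁-cong n (λ k j → ⨁-cong j (λ i l → *-leftComm (p i) (q k) (u l))) ⟩
  ⨁ n (λ k j → ⨁ j (λ i l → q k * (p i * u l)))
    ≡⟨ ⨁-cong n (λ k j → ⨁-* j (q k) _) ⟨
  ⨁ n (λ k j → q k * ⨁ j (λ i l → p i * u l)) ∎
  where open ≡-Reasoning

·-order : ∀ (p q : Power) a b → (∀ n → n < a → p n ≡ 0ℚ) → (∀ n → n < b → q n ≡ 0ℚ) →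
          ∀ n → n < a ℕ.+ b → (p · q) n ≡ 0ℚ
·-order p q a b e₁ e₂ n lt = ⨁-zero n term
  where
  term : ∀ i j → i ℕ.+ j ≡ n → p i * q j ≡ 0ℚ
  term i j refl with ℕ.≤-<-connex a i
  ... | inj₂ i<a = trans (cong (_* q j) (e₁ i i<a)) (ℚ.*-zeroˡ (q j))
  ... | inj₁ a≤i = trans (cong (p i *_) (e₂ j j<b)) (ℚ.*-zeroʳ (p i))
    where
    j<b : j < b
    j<b = ℕ.+-cancelˡ-< i j b (ℕ.<-≤-trans lt (ℕ.+-monoˡ-≤ b a≤i))

^-order : ∀ (p : Power) → p 0 ≡ 0ℚ → ∀ k n → n < k → (p ^ k) n ≡ 0ℚ
^-order p p0 (suc k) = ·-order p (p ^ k) 1 k order₁ (^-order p p0 k)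
  where
  order₁ : ∀ n → n < 1 → p n ≡ 0ℚ
  order₁ zero    _         = p0
  order₁ (suc _) (s≤s ())

generating-symmetric : ∀ f {α β} → α ↭ β → generating f α ≗ generating f β
generating-symmetric f refl n = refl
generating-symmetric f (prep a r) n =
  ·-cong {p = f ^ a} (λ _ → refl) (generating-symmetric f r) n
generating-symmetric f {_ ∷ _ ∷ α} (swap a b r) n = trans
  (·-leftComm (f ^ a) (f ^ b) (generating f α) n)
  (·-cong {p = f ^ b} (λ _ → refl)
    (·-cong {p = f ^ a} (λ _ → refl) (generating-symmetric f r)) n)
generating-symmetric f (↭trans r r′) n =
  trans (generating-symmetric f r n) (generating-symmetric f r′ n)

generating-stable : ∀ f α → generating f (α ∷ʳ 0) ≗ generating f α
generating-stable f []      zero    = refl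
generating-stable f []      (suc n) = trans
  (cong₂ _+_ (ℚ.*-zeroʳ 1ℚ) (⨁-zero n (λ i j _ → ℚ.*-zeroˡ (1ᵖ j))))
  (ℚ.+-identityˡ 0ℚ)
generating-stable f (a ∷ α) n =
  ·-cong {p = f ^ a} (λ _ → refl) (generating-stable f α) n

generating-order : ∀ f → f 0 ≡ 0ℚ → ∀ α n → n < sum α → generating f α n ≡ 0ℚ
generating-order f f0 (a ∷ α) =
  ·-order (f ^ a) (generating f α) a (sum α) (^-order f f0 a) (generating-order f f0 α)

r : DeltaSeries → ℕ → Λ
r f n = record
  { coeff     = λ α → generating (series f) α n
  ; symmetric = λ p → generating-symmetric (series f) p n
  ; stable    = λ α → generating-stable (series f) α n
  ; degree    = n
  ; bounded   = λ α lt → generating-order (series f) (constant f) α n lt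
  }

-- The ring homomorphism structure includes compatibility with _≈_.
record IsAlgebraHomomorphism (U : Λ → Λ) : Set where
  field
    isRingHomomorphism : IsRingHomomorphism Λ-rawRing Λ-rawRing U
    •-homo             : ∀ q F → U (q • F) ≈ q • U F

record IsUmbralOperator (f : DeltaSeries) (U : Λ → Λ) : Set where
  field
    isAlgebraHomomorphism : IsAlgebraHomomorphism U
    U-h                   : ∀ n → U (h n) ≈ r f n

eℤ : ℤ → Λ
eℤ (ℤ.+ n)  = e n
eℤ -[1+ _ ] = 0Λ

sign : ℕ → ℚ
sign zero    = 1ℚ
sign (suc k) = - sign k

-- C(z) = ∏ₓ (1 - xz) · 𝒯(1/z) with ∏ₓ (1 - xz) = Σₙ (-1)ⁿ eₙ zⁿ and
-- 𝒯(1/z) = Σₖ z⁻ᵏ 𝒯 k, so the coefficient (-1)ᵐ Cₘ of zᵐ is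
-- Σₖ (-1)ᵐ⁺ᵏ eₘ₊ₖ 𝒯 k.  On F, the terms with k > degree F vanish.
C : ℤ → Λ → Λ
C m F = ∑Λ (upTo (suc (degree F))) (λ k → sign k • (eℤ (m ℤ.+ (ℤ.+ k)) *Λ 𝒯 k F))

-- The operator C^f_m, given the umbral operators of f and of its inverse g.
Cᶠ : (U_f U_g : Λ → Λ) → ℤ → Λ → Λ
Cᶠ U_f U_g m = U_f ∘ C m ∘ U_g

P : (U_f U_g : Λ → Λ) → Partition → Λ
P U_f U_g p = foldr (λ m → Cᶠ U_f U_g (ℤ.+ m)) 1Λ (conjugate p)

record IsBasis (B : Partition → Λ) : Set where
  field
    spanning    : ∀ F → ∃[ L ] F ≈ ∑Λ {ℚ × Partition} L (λ (q , μ) → q • B μ)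
    independent : ∀ (L : List Partition) (a : Partition → ℚ) → Unique L →
                  ∑Λ L (λ μ → a μ • B μ) ≈ 0Λ → ∀ {μ} → μ ∈ L → a μ ≡ 0ℚ

-- For every λ, B_λ(X + X′) = Σ_{μ,ν} c^λ_{μν} B_μ(X) B_ν(X′).  The sum over all
-- pairs is finite: for fixed λ it runs over a repetition-free list of pairs
-- outside of which c^λ_{μν} = 0.
IsLRType : (Partition → Partition → Partition → ℚ) → (Partition → Series) → Set
IsLRType c B = ∀ p →
  Σ[ L ∈ List (Partition × Partition) ]
    Unique L
  × (∀ μ ν → c p μ ν ≢ 0ℚ → (μ , ν) ∈ L)
  × (∀ α β → (B p [X+X′]) α β ≡ ∑ L (λ (μ , ν) → c p μ ν * (B μ α * B ν β)))

IsLittlewoodRichardson : (Partition → Partition → Partition → ℚ) → Set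
IsLittlewoodRichardson c = IsLRType c s

{-# OPTIONS --safe #-}
module Submission where

-- The operators C^f_m are conjugates of the column operators C_m by U_f, and U_g is
-- inverse to U_f, so P_λ = U_f(S_λ), where S_λ is obtained by applying the C_m with m
-- running through λ′ to 1.  The theorem follows from three facts.
--
-- S_λ is the Schur function s_λ, the generating function of tableaux (schur-s).  From
-- 𝒯(u) C(z) = (1 - uz) C(z) 𝒯(u) one gets that 𝒯 a removes at most one cell from each
-- column of λ, a cells altogether (𝒯-𝒞), and the removals that do not leave a partition
-- contribute zero since C_m C_(m+1) = 0 (𝒞-𝒞).  What remains is the branching rule
-- (𝒮-branching): 𝒯 a s_λ is the sum of the s_μ such that λ/μ is a horizontal strip of
-- size a.  This is the recursion that counts tableaux by their largest letter.
--
-- The Schur functions form a basis of Λ (schur-spanning, schur-independent), as the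
-- matrix of their coefficients at the monomials indexed by partitions is unitriangular
-- for the lexicographic order (𝒮-high, 𝒮-full).  All C_m preserve the algebra generated
-- by the hₙ, so Λ is generated by the hₙ (polynomial).  It therefore suffices to verify
-- on the hₙ that U_g and U_f are mutually inverse (umbral-inverse), and the P_λ form a
-- basis as well.
--
-- U_f is compatible with F ↦ F(X + X′): if F(X + X′) = Σ A(X) B(X′), then (U_f F)(X + X′)
-- = Σ (U_f A)(X) (U_f B)(X′).  For one particular expansion of F (splitting) this is again
-- checked on the generators, where it is the multiplicativity of f(z)^(a+b); that it then
-- holds for any expansion follows by fixing the variables X or X′ and using that U_f is
-- linear (U⊗U-cong).  For F = s_λ and its Littlewood-Richardson expansion this is the
-- claimed formula.

open import Algebra.Morphism.Structures using (IsRingHomomorphism)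
open import Data.Bool.Base using (true; false)
open import Data.Empty using (⊥-elim)
import Data.Integer.Base as ℤ
open import Data.List.Base
  using (List; []; _∷_; _++_; _∷ʳ_; map; foldr; reverse; filter; length; upTo; applyUpTo;
         cartesianProductWith)
open import Data.List.Membership.Propositional using (_∈_)
open import Data.List.Membership.Propositional.Properties
  using (∈-map⁻; ∈-upTo⁻; ∈-upTo⁺; ∈-map⁺; ∈-++⁺ˡ; ∈-++⁺ʳ; ∈-filter⁺; ∈-filter⁻)
import Data.List.Properties as List
open import Data.List.Relation.Binary.Permutation.Propositional using (swap; ↭-sym; ↭-refl)
open import Data.List.Relation.Binary.Permutation.Propositional.Properties
  using (∷↭∷ʳ; ↭-reverse; All-resp-↭)
open import Data.List.Relation.Unary.All as All using (All; []; _∷_)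
import Data.List.Relation.Unary.All.Properties as All
open import Data.List.Relation.Unary.AllPairs as AllPairs using (AllPairs; []; _∷_)
import Data.List.Relation.Unary.AllPairs.Properties as AllPairs
open import Data.List.Relation.Unary.Any using (here; there)
open import Data.List.Relation.Unary.Linked as Linked using (Linked; []; [-]; _∷_)
open import Data.List.Relation.Unary.Unique.Propositional using (Unique)
import Data.List.Relation.Unary.Unique.Propositional.Properties as Unique
open import Data.Nat.Base as ℕ using (ℕ; zero; suc; _≤_; _<_; _≥_; z≤n; s≤s)
open import Data.Nat.ListAction using (sum)
open import Data.Nat.ListAction.Properties using (sum-↭; sum-++)
import Data.Nat.Properties as ℕ
open import Data.Product.Base using (_×_; _,_; proj₁; proj₂; uncurry; Σ-syntax; ∃-syntax)
open import Data.Rational.Base using (ℚ; 0ℚ; 1ℚ; _+_; _*_; -_)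
import Data.Rational.Properties as ℚ
open import Data.Rational.Solver using (module +-*-Solver)
open import Data.Sum.Base using (_⊎_; inj₁; inj₂)
open import Function.Base using (_∘_; id)
open import Relation.Binary.Definitions using (tri<; tri≈; tri>)
open import Relation.Binary.Properties.DecTotalOrder ℕ.≤-decTotalOrder using (≥-decTotalOrder)
open import Relation.Binary.PropositionalEquality
  using (_≡_; _≢_; _≗_; refl; sym; trans; cong; cong₂; subst; setoid; module ≡-Reasoning)
open import Relation.Nullary.Decidable.Core using (Dec; yes; no)
open import Relation.Nullary.Negation.Core using (contradiction)
open import Defs

open import Data.List.Sort ≥-decTotalOrder using (sort; sort-↭; sort-↗)

-- Finite sums of rational numbers

+-interchange : ∀ a b c d → (a + b) + (c + d) ≡ (a + c) + (b + d)
+-interchange = solve 4 (λ a b c d → (a :+ b) :+ (c :+ d) := (a :+ c) :+ (b :+ d)) refl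
  where open +-*-Solver

*-interchange : ∀ a b c d → (a * b) * (c * d) ≡ (a * c) * (b * d)
*-interchange = solve 4 (λ a b c d → (a :* b) :* (c :* d) := (a :* c) :* (b :* d)) refl
  where open +-*-Solver

*-leftComm : ∀ a b c → a * (b * c) ≡ b * (a * c)
*-leftComm = solve 3 (λ a b c → a :* (b :* c) := b :* (a :* c)) refl
  where open +-*-Solver

0+0 : ∀ {a b} → a ≡ 0ℚ → b ≡ 0ℚ → a + b ≡ 0ℚ
0+0 p q = trans (cong₂ _+_ p q) (ℚ.+-identityˡ 0ℚ)

0+ : ∀ {a} b → a ≡ 0ℚ → a + b ≡ b
0+ b p = trans (cong (_+ b) p) (ℚ.+-identityˡ b)

+0 : ∀ a {b} → b ≡ 0ℚ → a + b ≡ a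
+0 a p = trans (cong (a +_) p) (ℚ.+-identityʳ a)

0* : ∀ {a} b → a ≡ 0ℚ → a * b ≡ 0ℚ
0* b p = trans (cong (_* b) p) (ℚ.*-zeroˡ b)

*0 : ∀ a {b} → b ≡ 0ℚ → a * b ≡ 0ℚ
*0 a p = trans (cong (a *_) p) (ℚ.*-zeroʳ a)

module _ {A : Set} where

  ∑-cong : ∀ xs {s t : A → ℚ} → s ≗ t → ∑ xs s ≡ ∑ xs t
  ∑-cong []       e = refl
  ∑-cong (x ∷ xs) e = cong₂ _+_ (e x) (∑-cong xs e)

  ∑-cong-All : ∀ {xs} {s t : A → ℚ} → All (λ x → s x ≡ t x) xs → ∑ xs s ≡ ∑ xs t
  ∑-cong-All []       = refl
  ∑-cong-All (e ∷ es) = cong₂ _+_ e (∑-cong-All es)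

  ∑-zero : ∀ {xs} {t : A → ℚ} → All (λ x → t x ≡ 0ℚ) xs → ∑ xs t ≡ 0ℚ
  ∑-zero []       = refl
  ∑-zero (e ∷ es) = 0+0 e (∑-zero es)

  ∑-zero′ : ∀ xs {t : A → ℚ} → (∀ x → t x ≡ 0ℚ) → ∑ xs t ≡ 0ℚ
  ∑-zero′ []       e = refl
  ∑-zero′ (x ∷ xs) e = 0+0 (e x) (∑-zero′ xs e)

  ∑-+ : ∀ xs (s t : A → ℚ) → ∑ xs (λ x → s x + t x) ≡ ∑ xs s + ∑ xs t
  ∑-+ []       s t = refl
  ∑-+ (x ∷ xs) s t = trans
    (cong ((s x + t x) +_) (∑-+ xs s t))
    (+-interchange (s x) (t x) (∑ xs s) (∑ xs t))

  ∑-*ˡ : ∀ xs q (t : A → ℚ) → q * ∑ xs t ≡ ∑ xs (λ x → q * t x)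
  ∑-*ˡ []       q t = ℚ.*-zeroʳ q
  ∑-*ˡ (x ∷ xs) q t = trans
    (ℚ.*-distribˡ-+ q (t x) (∑ xs t)) (cong (q * t x +_) (∑-*ˡ xs q t))

  ∑-++ : ∀ xs ys (t : A → ℚ) → ∑ (xs ++ ys) t ≡ ∑ xs t + ∑ ys t
  ∑-++ []       ys t = sym (ℚ.+-identityˡ (∑ ys t))
  ∑-++ (x ∷ xs) ys t = trans
    (cong (t x +_) (∑-++ xs ys t)) (sym (ℚ.+-assoc (t x) (∑ xs t) (∑ ys t)))

  ∑-⨁ : ∀ xs n (t : A → ℕ → ℕ → ℚ) →
        ⨁ n (λ i j → ∑ xs (λ x → t x i j)) ≡ ∑ xs (λ x → ⨁ n (t x))
  ∑-⨁ []       n t = ⨁-zero n (λ _ _ _ → refl)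
  ∑-⨁ (x ∷ xs) n t = trans
    (⨁-+ n (t x) (λ i j → ∑ xs (λ x → t x i j))) (cong (⨁ n (t x) +_) (∑-⨁ xs n t))

  -- A sum with at most one nonzero term.
  ∑-unique : ∀ {xs y} (t : A → ℚ) → Unique xs → y ∈ xs →
             (∀ {x} → x ∈ xs → x ≢ y → t x ≡ 0ℚ) → ∑ xs t ≡ t y
  ∑-unique {x ∷ xs} t (x∉ ∷ u) (here refl) off =
    +0 (t x) (∑-zero (go x∉ (off ∘ there)))
    where
    go : ∀ {ys} → All (x ≢_) ys → (∀ {x′} → x′ ∈ ys → x′ ≢ x → t x′ ≡ 0ℚ) →
         All (λ x → t x ≡ 0ℚ) ys
    go []       o = []
    go (p ∷ ps) o = o (here refl) (p ∘ sym) ∷ go ps (o ∘ there)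
  ∑-unique {x ∷ xs} {y} t (x∉ ∷ u) (there y∈) off = trans
    (0+ (∑ xs t) (off (here refl) (neq x∉ y∈)))
    (∑-unique t u y∈ (off ∘ there))
    where
    neq : ∀ {ys} → All (x ≢_) ys → y ∈ ys → x ≢ y
    neq (p ∷ _)  (here refl) = p
    neq (_ ∷ ps) (there q)   = neq ps q

module _ {A B : Set} where

  ∑-map : ∀ (f : A → B) xs (t : B → ℚ) → ∑ (map f xs) t ≡ ∑ xs (t ∘ f)
  ∑-map f []       t = refl
  ∑-map f (x ∷ xs) t = cong (t (f x) +_) (∑-map f xs t)

  ∑-swap : ∀ xs ys (t : A → B → ℚ) →
           ∑ xs (λ x → ∑ ys (t x)) ≡ ∑ ys (λ y → ∑ xs (λ x → t x y))
  ∑-swap []       ys t = sym (∑-zero′ ys (λ _ → refl))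
  ∑-swap (x ∷ xs) ys t = trans
    (cong (∑ ys (t x) +_) (∑-swap xs ys t))
    (sym (∑-+ ys (t x) (λ y → ∑ xs (λ x → t x y))))

∑-× : ∀ {A B C : Set} (f : A → B → C) xs ys (t : C → ℚ) →
      ∑ (cartesianProductWith f xs ys) t ≡ ∑ xs (λ x → ∑ ys (λ y → t (f x y)))
∑-× f []       ys t = refl
∑-× f (x ∷ xs) ys t = trans
  (∑-++ (map (f x) ys) (cartesianProductWith f xs ys) t)
  (cong₂ _+_ (∑-map (f x) ys t) (∑-× f xs ys t))

-- The sum of t 0, …, t (n-1).
Σ< : ℕ → (ℕ → ℚ) → ℚ
Σ< zero    t = 0ℚ
Σ< (suc n) t = t 0 + Σ< n (t ∘ suc)

∑-applyUpTo : ∀ (f : ℕ → ℕ) n t → ∑ (applyUpTo f n) t ≡ Σ< n (t ∘ f)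
∑-applyUpTo f zero    t = refl
∑-applyUpTo f (suc n) t = cong (t (f 0) +_) (∑-applyUpTo (f ∘ suc) n t)

∑-upTo : ∀ n t → ∑ (upTo n) t ≡ Σ< n t
∑-upTo = ∑-applyUpTo id

Σ<-cong : ∀ n {s t : ℕ → ℚ} → s ≗ t → Σ< n s ≡ Σ< n t
Σ<-cong zero    e = refl
Σ<-cong (suc n) e = cong₂ _+_ (e 0) (Σ<-cong n (e ∘ suc))

Σ<-zero : ∀ n {t : ℕ → ℚ} → (∀ i → t i ≡ 0ℚ) → Σ< n t ≡ 0ℚ
Σ<-zero zero    e = refl
Σ<-zero (suc n) e = 0+0 (e 0) (Σ<-zero n (e ∘ suc))

Σ<-+ : ∀ n (s t : ℕ → ℚ) → Σ< n (λ i → s i + t i) ≡ Σ< n s + Σ< n t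
Σ<-+ zero    s t = refl
Σ<-+ (suc n) s t = trans
  (cong ((s 0 + t 0) +_) (Σ<-+ n (s ∘ suc) (t ∘ suc)))
  (+-interchange (s 0) (t 0) (Σ< n (s ∘ suc)) (Σ< n (t ∘ suc)))

Σ<-* : ∀ n q (t : ℕ → ℚ) → q * Σ< n t ≡ Σ< n (λ i → q * t i)
Σ<-* zero    q t = ℚ.*-zeroʳ q
Σ<-* (suc n) q t = trans
  (ℚ.*-distribˡ-+ q (t 0) (Σ< n (t ∘ suc))) (cong (q * t 0 +_) (Σ<-* n q (t ∘ suc)))

Σ<-swap : ∀ m n (t : ℕ → ℕ → ℚ) →
          Σ< m (λ i → Σ< n (t i)) ≡ Σ< n (λ j → Σ< m (λ i → t i j))
Σ<-swap zero    n t = sym (Σ<-zero n (λ _ → refl))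
Σ<-swap (suc m) n t = trans
  (cong (Σ< n (t 0) +_) (Σ<-swap m n (t ∘ suc)))
  (sym (Σ<-+ n (t 0) (λ j → Σ< m (λ i → t (suc i) j))))

-- Terms that vanish may be omitted at the upper end.
Σ<-extend : ∀ {m n} → m ≤ n → (t : ℕ → ℚ) → (∀ i → m ≤ i → t i ≡ 0ℚ) → Σ< n t ≡ Σ< m t
Σ<-extend {n = n} z≤n       t e = Σ<-zero n (λ i → e i z≤n)
Σ<-extend         (s≤s m≤n) t e = cong (t 0 +_) (Σ<-extend m≤n (t ∘ suc) (λ i le → e (suc i) (s≤s le)))

Σ<-⨁ : ∀ n k (t : ℕ → ℕ → ℕ → ℚ) →
       ⨁ k (λ i j → Σ< n (λ x → t x i j)) ≡ Σ< n (λ x → ⨁ k (t x))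
Σ<-⨁ zero    k t = ⨁-zero k (λ _ _ _ → refl)
Σ<-⨁ (suc n) k t = trans
  (⨁-+ k (t 0) (λ i j → Σ< n (λ x → t (suc x) i j)))
  (cong (⨁ k (t 0) +_) (Σ<-⨁ n k (t ∘ suc)))

Σ<-last : ∀ n (u : ℕ → ℚ) → Σ< (suc n) u ≡ u n + Σ< n u
Σ<-last zero    u = refl
Σ<-last (suc n) u = begin
  u 0 + Σ< (suc n) (u ∘ suc)         ≡⟨ cong (u 0 +_) (Σ<-last n (u ∘ suc)) ⟩
  u 0 + (u (suc n) + Σ< n (u ∘ suc)) ≡⟨ +-leftComm (u 0) (u (suc n)) (Σ< n (u ∘ suc)) ⟩
  u (suc n) + (u 0 + Σ< n (u ∘ suc)) ∎
  where
  open ≡-Reasoning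
  +-leftComm : ∀ a b c → a + (b + c) ≡ b + (a + c)
  +-leftComm = solve 3 (λ a b c → a :+ (b :+ c) := b :+ (a :+ c)) refl where open +-*-Solver

⨁-sym : ∀ n (t : ℕ → ℕ → ℚ) → ⨁ n t ≡ ⨁ n (λ i j → t j i)
⨁-sym n t = trans (go₁ n t) (sym (go₂ n t))
  where
  -- Both sums are equal to the sum of the t i (n - i).
  go₁ : ∀ n t → ⨁ n t ≡ Σ< (suc n) (λ i → t i (n ℕ.∸ i))
  go₁ zero    t = sym (ℚ.+-identityʳ (t 0 0))
  go₁ (suc n) t = cong (t 0 (suc n) +_) (go₁ n (t ∘ suc))
  cong< : ∀ n {s t : ℕ → ℚ} → (∀ i → i < n → s i ≡ t i) → Σ< n s ≡ Σ< n t
  cong< zero    e = refl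
  cong< (suc n) e = cong₂ _+_ (e 0 (s≤s z≤n)) (cong< n (λ i lt → e (suc i) (s≤s lt)))
  go₂ : ∀ n t → ⨁ n (λ i j → t j i) ≡ Σ< (suc n) (λ i → t i (n ℕ.∸ i))
  go₂ zero    t = sym (ℚ.+-identityʳ (t 0 0))
  go₂ (suc n) t = begin
    t (suc n) 0 + ⨁ n (λ i j → t j (suc i))
      ≡⟨ cong₂ _+_ (cong (t (suc n)) (sym (ℕ.n∸n≡0 n))) (go₂ n (λ i j → t i (suc j))) ⟩
    t (suc n) (n ℕ.∸ n) + Σ< (suc n) (λ i → t i (suc (n ℕ.∸ i)))
      ≡⟨ cong (t (suc n) (n ℕ.∸ n) +_)
           (cong< (suc n) (λ { i (s≤s le) → cong (t i) (sym (ℕ.+-∸-assoc 1 le)) })) ⟩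
    t (suc n) (n ℕ.∸ n) + Σ< (suc n) (λ i → t i (suc n ℕ.∸ i))
      ≡⟨ Σ<-last (suc n) (λ i → t i (suc n ℕ.∸ i)) ⟨
    Σ< (suc (suc n)) (λ i → t i (suc n ℕ.∸ i)) ∎
    where open ≡-Reasoning

-- A convolution of which only the term with i = 0 survives.
⨁-first : ∀ n (t : ℕ → ℕ → ℚ) → (∀ i j → t (suc i) j ≡ 0ℚ) → ⨁ n t ≡ t 0 n
⨁-first zero    t e = refl
⨁-first (suc n) t e = +0 (t 0 (suc n)) (⨁-zero n (λ i j _ → e i j))

-- Summing by diagonals and by rows, when all terms with i + j ≥ K vanish.
⨁-square : ∀ K {M} → K ≤ M → (t : ℕ → ℕ → ℚ) → (∀ i j → K ≤ i ℕ.+ j → t i j ≡ 0ℚ) →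
           Σ< K (λ k → ⨁ k t) ≡ Σ< K (λ i → Σ< M (t i))
⨁-square zero    _       t e = refl
⨁-square (suc K) {M} K<M t e = begin
  t 0 0 + Σ< K (λ k → t 0 (suc k) + ⨁ k (t ∘ suc))
    ≡⟨ cong (t 0 0 +_) (Σ<-+ K (t 0 ∘ suc) (λ k → ⨁ k (t ∘ suc))) ⟩
  t 0 0 + (Σ< K (t 0 ∘ suc) + Σ< K (λ k → ⨁ k (t ∘ suc)))
    ≡⟨ ℚ.+-assoc (t 0 0) _ _ ⟨
  Σ< (suc K) (t 0) + Σ< K (λ k → ⨁ k (t ∘ suc))
    ≡⟨ cong₂ _+_ (sym (Σ<-extend K<M (t 0) (e 0)))
         (⨁-square K (ℕ.<⇒≤ K<M) (t ∘ suc) (λ i j le → e (suc i) j (s≤s le))) ⟩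
  Σ< M (t 0) + Σ< K (λ i → Σ< M (t (suc i))) ∎
  where open ≡-Reasoning

-- The terms of ⨁ n need only agree on the indices with i + j = n.
⨁-cong-≡ : ∀ n {s t : ℕ → ℕ → ℚ} → (∀ i j → i ℕ.+ j ≡ n → s i j ≡ t i j) → ⨁ n s ≡ ⨁ n t
⨁-cong-≡ zero    p = p 0 0 refl
⨁-cong-≡ (suc n) p = cong₂ _+_ (p 0 (suc n) refl)
  (⨁-cong-≡ n (λ i j eq → p (suc i) j (cong suc eq)))

-- Products of formal power series

⊛-comm : ∀ (F G : Series) → F ⊛ G ≗ G ⊛ F
⊛-comm F G []      = ℚ.*-comm (F []) (G [])
⊛-comm F G (a ∷ α) = trans
  (⨁-cong a (λ i j → ⊛-comm (F ∘ (i ∷_)) (G ∘ (j ∷_)) α))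
  (⨁-sym a (λ i j → ((G ∘ (j ∷_)) ⊛ (F ∘ (i ∷_))) α))

⊛-+ʳ : ∀ (F G H : Series) α → (F ⊛ (λ γ → G γ + H γ)) α ≡ (F ⊛ G) α + (F ⊛ H) α
⊛-+ʳ F G H []      = ℚ.*-distribˡ-+ (F []) (G []) (H [])
⊛-+ʳ F G H (a ∷ α) = trans
  (⨁-cong a (λ i j → ⊛-+ʳ (F ∘ (i ∷_)) (G ∘ (j ∷_)) (H ∘ (j ∷_)) α))
  (⨁-+ a (λ i j → ((F ∘ (i ∷_)) ⊛ (G ∘ (j ∷_))) α) (λ i j → ((F ∘ (i ∷_)) ⊛ (H ∘ (j ∷_))) α))

⊛-*ʳ : ∀ (F : Series) q (G : Series) α → (F ⊛ (λ γ → q * G γ)) α ≡ q * (F ⊛ G) α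
⊛-*ʳ F q G []      = *-leftComm (F []) q (G [])
⊛-*ʳ F q G (a ∷ α) = trans
  (⨁-cong a (λ i j → ⊛-*ʳ (F ∘ (i ∷_)) q (G ∘ (j ∷_)) α))
  (sym (⨁-* a q (λ i j → ((F ∘ (i ∷_)) ⊛ (G ∘ (j ∷_))) α)))

⊛-zeroʳ : ∀ (F G : Series) → (∀ γ → G γ ≡ 0ℚ) → ∀ α → (F ⊛ G) α ≡ 0ℚ
⊛-zeroʳ F G e []      = *0 (F []) (e [])
⊛-zeroʳ F G e (a ∷ α) = ⨁-zero a (λ i j _ → ⊛-zeroʳ (F ∘ (i ∷_)) (G ∘ (j ∷_)) (e ∘ (j ∷_)) α)

⊛-zeroˡ : ∀ (F G : Series) → (∀ γ → F γ ≡ 0ℚ) → ∀ α → (F ⊛ G) α ≡ 0ℚ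
⊛-zeroˡ F G e α = trans (⊛-comm F G α) (⊛-zeroʳ G F e α)

⊛-∑ʳ : ∀ {A : Set} (F : Series) xs (q : A → ℚ) (G : A → Series) α →
       (F ⊛ (λ γ → ∑ xs (λ x → q x * G x γ))) α ≡ ∑ xs (λ x → q x * (F ⊛ G x) α)
⊛-∑ʳ F []       q G α = ⊛-zeroʳ F _ (λ _ → refl) α
⊛-∑ʳ F (x ∷ xs) q G α = trans
  (⊛-+ʳ F (λ γ → q x * G x γ) (λ γ → ∑ xs (λ x → q x * G x γ)) α)
  (cong₂ _+_ (⊛-*ʳ F (q x) (G x) α) (⊛-∑ʳ F xs q G α))

⊛-∑ˡ : ∀ {A : Set} (F : Series) xs (q : A → ℚ) (G : A → Series) α →
       ((λ γ → ∑ xs (λ x → q x * G x γ)) ⊛ F) α ≡ ∑ xs (λ x → q x * (G x ⊛ F) α)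
⊛-∑ˡ F xs q G α = begin
  ((λ γ → ∑ xs (λ x → q x * G x γ)) ⊛ F) α ≡⟨ ⊛-comm _ F α ⟩
  (F ⊛ (λ γ → ∑ xs (λ x → q x * G x γ))) α ≡⟨ ⊛-∑ʳ F xs q G α ⟩
  ∑ xs (λ x → q x * (F ⊛ G x) α)
    ≡⟨ ∑-cong xs (λ x → cong (q x *_) (⊛-comm F (G x) α)) ⟩
  ∑ xs (λ x → q x * (G x ⊛ F) α) ∎
  where open ≡-Reasoning

⊛-Σ<ʳ : ∀ (F : Series) n (G : ℕ → Series) α →
        (F ⊛ (λ γ → Σ< n (λ k → G k γ))) α ≡ Σ< n (λ k → (F ⊛ G k) α)
⊛-Σ<ʳ F zero    G α = ⊛-zeroʳ F _ (λ _ → refl) α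
⊛-Σ<ʳ F (suc n) G α = trans
  (⊛-+ʳ F (G 0) (λ γ → Σ< n (λ k → G (suc k) γ)) α)
  (cong ((F ⊛ G 0) α +_) (⊛-Σ<ʳ F n (G ∘ suc) α))

⊛-⨁ʳ : ∀ (F : Series) n (G : ℕ → ℕ → Series) α →
       (F ⊛ (λ γ → ⨁ n (λ k l → G k l γ))) α ≡ ⨁ n (λ k l → (F ⊛ G k l) α)
⊛-⨁ʳ F zero    G α = refl
⊛-⨁ʳ F (suc n) G α = trans
  (⊛-+ʳ F (G 0 (suc n)) (λ γ → ⨁ n (λ k l → G (suc k) l γ)) α)
  (cong ((F ⊛ G 0 (suc n)) α +_) (⊛-⨁ʳ F n (G ∘ suc) α))

⊛-leftComm : ∀ (F G H : Series) → F ⊛ (G ⊛ H) ≗ G ⊛ (F ⊛ H)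
⊛-leftComm F G H []      = *-leftComm (F []) (G []) (H [])
⊛-leftComm F G H (a ∷ α) = begin
  ⨁ a (λ i j → ((F ∘ (i ∷_)) ⊛ (λ γ → ⨁ j (λ k l → ((G ∘ (k ∷_)) ⊛ (H ∘ (l ∷_))) γ))) α)
    ≡⟨ ⨁-cong a (λ i j → ⊛-⨁ʳ (F ∘ (i ∷_)) j _ α) ⟩
  ⨁ a (λ i j → ⨁ j (λ k l → ((F ∘ (i ∷_)) ⊛ ((G ∘ (k ∷_)) ⊛ (H ∘ (l ∷_)))) α))
    ≡⟨ ⨁-leftComm a (λ i k l → ((F ∘ (i ∷_)) ⊛ ((G ∘ (k ∷_)) ⊛ (H ∘ (l ∷_)))) α) ⟩
  ⨁ a (λ k j → ⨁ j (λ i l → ((F ∘ (i ∷_)) ⊛ ((G ∘ (k ∷_)) ⊛ (H ∘ (l ∷_)))) α))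
    ≡⟨ ⨁-cong a (λ k j → ⨁-cong j (λ i l →
         ⊛-leftComm (F ∘ (i ∷_)) (G ∘ (k ∷_)) (H ∘ (l ∷_)) α)) ⟩
  ⨁ a (λ k j → ⨁ j (λ i l → ((G ∘ (k ∷_)) ⊛ ((F ∘ (i ∷_)) ⊛ (H ∘ (l ∷_)))) α))
    ≡⟨ ⨁-cong a (λ k j → ⊛-⨁ʳ (G ∘ (k ∷_)) j _ α) ⟨
  ⨁ a (λ k j → ((G ∘ (k ∷_)) ⊛ (λ γ → ⨁ j (λ i l → ((F ∘ (i ∷_)) ⊛ (H ∘ (l ∷_))) γ))) α) ∎
  where open ≡-Reasoning

-- If F(X + X′) and G(X + X′) are given as sums of products, so is (F ⊛ G)(X + X′).
⊛-++ : ∀ {A B : Set} (F G : Series) xs ys (F₁ F₂ : A → Series) (G₁ G₂ : B → Series) →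
       (∀ α β → F (α ++ β) ≡ ∑ xs (λ x → F₁ x α * F₂ x β)) →
       (∀ α β → G (α ++ β) ≡ ∑ ys (λ y → G₁ y α * G₂ y β)) →
       ∀ α β → (F ⊛ G) (α ++ β) ≡
         ∑ xs (λ x → ∑ ys (λ y → (F₁ x ⊛ G₁ y) α * (F₂ x ⊛ G₂ y) β))
⊛-++ F G xs ys F₁ F₂ G₁ G₂ p p′ [] β = begin
  (F ⊛ G) β
    ≡⟨ ⊛-cong (p []) (p′ []) β ⟩
  ((λ γ → ∑ xs (λ x → F₁ x [] * F₂ x γ)) ⊛ (λ γ → ∑ ys (λ y → G₁ y [] * G₂ y γ))) β
    ≡⟨ ⊛-∑ˡ _ xs (λ x → F₁ x []) F₂ β ⟩
  ∑ xs (λ x → F₁ x [] * (F₂ x ⊛ (λ γ → ∑ ys (λ y → G₁ y [] * G₂ y γ))) β)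
    ≡⟨ ∑-cong xs (λ x → cong (F₁ x [] *_) (⊛-∑ʳ (F₂ x) ys (λ y → G₁ y []) G₂ β)) ⟩
  ∑ xs (λ x → F₁ x [] * ∑ ys (λ y → G₁ y [] * (F₂ x ⊛ G₂ y) β))
    ≡⟨ ∑-cong xs (λ x → trans (∑-*ˡ ys (F₁ x []) _) (∑-cong ys (λ y →
         sym (ℚ.*-assoc (F₁ x []) (G₁ y []) ((F₂ x ⊛ G₂ y) β))))) ⟩
  ∑ xs (λ x → ∑ ys (λ y → (F₁ x [] * G₁ y []) * (F₂ x ⊛ G₂ y) β)) ∎
  where open ≡-Reasoning
⊛-++ F G xs ys F₁ F₂ G₁ G₂ p p′ (a ∷ α) β = begin
  ⨁ a (λ i j → ((F ∘ (i ∷_)) ⊛ (G ∘ (j ∷_))) (α ++ β))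
    ≡⟨ ⨁-cong a (λ i j → ⊛-++ (F ∘ (i ∷_)) (G ∘ (j ∷_)) xs ys
         (λ x → F₁ x ∘ (i ∷_)) F₂ (λ y → G₁ y ∘ (j ∷_)) G₂
         (λ γ → p (i ∷ γ)) (λ γ → p′ (j ∷ γ)) α β) ⟩
  ⨁ a (λ i j → ∑ xs (λ x → ∑ ys (λ y → term x y i j)))
    ≡⟨ ∑-⨁ xs a (λ x i j → ∑ ys (λ y → term x y i j)) ⟩
  ∑ xs (λ x → ⨁ a (λ i j → ∑ ys (λ y → term x y i j)))
    ≡⟨ ∑-cong xs (λ x → ∑-⨁ ys a (term x)) ⟩
  ∑ xs (λ x → ∑ ys (λ y → ⨁ a (term x y)))
    ≡⟨ ∑-cong xs (λ x → ∑-cong ys (λ y → ⨁-*ʳ a ((F₂ x ⊛ G₂ y) β)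
         (λ i j → ((F₁ x ∘ (i ∷_)) ⊛ (G₁ y ∘ (j ∷_))) α))) ⟩
  ∑ xs (λ x → ∑ ys (λ y → (F₁ x ⊛ G₁ y) (a ∷ α) * (F₂ x ⊛ G₂ y) β)) ∎
  where
  open ≡-Reasoning
  term = λ x y i j → ((F₁ x ∘ (i ∷_)) ⊛ (G₁ y ∘ (j ∷_))) α * (F₂ x ⊛ G₂ y) β
  ⨁-*ʳ : ∀ n q t → ⨁ n (λ i j → t i j * q) ≡ ⨁ n t * q
  ⨁-*ʳ n q t = trans (⨁-cong n (λ i j → ℚ.*-comm (t i j) q))
    (trans (sym (⨁-* n q t)) (ℚ.*-comm q (⨁ n t)))

-- Symmetric functions

∑Λ-coeff : ∀ {A : Set} xs (t : A → Λ) α → coeff (∑Λ xs t) α ≡ ∑ xs (λ x → coeff (t x) α)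
∑Λ-coeff []       t α = refl
∑Λ-coeff (x ∷ xs) t α = cong (coeff (t x) α +_) (∑Λ-coeff xs t α)

coeff-0∷ : ∀ F α → coeff F (0 ∷ α) ≡ coeff F α
coeff-0∷ F α = trans (symmetric F (∷↭∷ʳ 0 α)) (stable F α)

-- The operators 𝒯 a and 𝒯 b commute.
𝒯-comm : ∀ a b F α → coeff F (a ∷ b ∷ α) ≡ coeff F (b ∷ a ∷ α)
𝒯-comm a b F α = symmetric F (swap a b ↭-refl)

𝒯-high : ∀ {a} F → degree F < a → ∀ α → coeff F (a ∷ α) ≡ 0ℚ
𝒯-high {a} F lt α = bounded F (a ∷ α) (ℕ.<-≤-trans lt (ℕ.m≤m+n a (sum α)))

⟦⟧-yes : {A : Set} (a? : Dec A) → A → ⟦ a? ⟧ ≡ 1ℚ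
⟦⟧-yes (yes _) _ = refl
⟦⟧-yes (no ¬a) a = contradiction a ¬a

-- The elementary symmetric functions are squarefree: 𝒯 1 lowers eₙ₊₁ to eₙ,
-- and 𝒯 a annihilates it for a > 1.
e-1∷ : ∀ n α → coeff (e (suc n)) (1 ∷ α) ≡ coeff (e n) α
e-1∷ n α = cong₂ _*_
  (⟦⟧-cong (squarefree? (1 ∷ α)) (squarefree? α) (λ { (_ ∷ p) → p }) (s≤s z≤n ∷_))
  (⟦⟧-cong (suc (sum α) ℕ.≟ suc n) (sum α ℕ.≟ n) ℕ.suc-injective (cong suc))

e-2∷ : ∀ n i α → coeff (e n) (suc (suc i) ∷ α) ≡ 0ℚ
e-2∷ n i α = 0* ⟦ suc (suc i) ℕ.+ sum α ℕ.≟ n ⟧ (⟦⟧-no (squarefree? (suc (suc i) ∷ α)) (λ { (s≤s () ∷ _) }))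

-- For n > 0 the constant term of eₙ is zero.
e-[] : ∀ n → coeff (e (suc n)) [] ≡ 0ℚ
e-[] n = *0 1ℚ refl

-- 𝒯 a lowers hₐ₊ₙ to hₙ and annihilates hₙ for n < a.
h-high : ∀ {n a} → n < a → ∀ α → coeff (h n) (a ∷ α) ≡ 0ℚ
h-high {n} {a} = 𝒯-high (h n)

h-+∷ : ∀ n a α → coeff (h (a ℕ.+ n)) (a ∷ α) ≡ coeff (h n) α
h-+∷ n a α = ⟦⟧-cong (a ℕ.+ sum α ℕ.≟ a ℕ.+ n) (sum α ℕ.≟ n)
  (ℕ.+-cancelˡ-≡ a (sum α) n) (cong (a ℕ.+_))

⊛-identityˡ : ∀ F → 1Λ *Λ F ≈ F
⊛-identityˡ F = go (coeff F)
  where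
  go : ∀ (F : Series) α → (coeff 1Λ ⊛ F) α ≡ F α
  go F []      = ℚ.*-identityˡ (F [])
  go F (a ∷ α) = trans
    (⨁-first a _ (λ i j → ⊛-zeroˡ _ (F ∘ (j ∷_)) (h-high {0} {suc i} (s≤s z≤n)) α))
    (go (F ∘ (a ∷_)) α)

e0≈1 : e 0 ≈ 1Λ
e0≈1 α with sum α ℕ.≟ 0
... | no  _  = ℚ.*-zeroʳ ⟦ squarefree? α ⟧
... | yes s0 = trans (ℚ.*-identityʳ ⟦ squarefree? α ⟧) (⟦⟧-yes (squarefree? α) (sqf α s0))
  where
  sqf : ∀ α → sum α ≡ 0 → All (_≤ 1) α
  sqf []         _ = []
  sqf (zero ∷ α) p = z≤n ∷ sqf α p

-- Column operators

-- The column operator C m for m ≥ 0.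
𝒞 : ℕ → Λ → Λ
𝒞 m = C (ℤ.+ m)

-- The defining sum of 𝒞 m, truncated to its first K terms.  On a symmetric function
-- of degree less than K it agrees with 𝒞 m, whose own truncation depends on the degree.
column : ℕ → ℕ → Series → Series
column K m F α = Σ< K (λ k → sign k * (coeff (e (m ℕ.+ k)) ⊛ (F ∘ (k ∷_))) α)

column-cong : ∀ K m {F G} → F ≗ G → column K m F ≗ column K m G
column-cong K m p α = Σ<-cong K (λ k →
  cong (sign k *_) (⊛-cong {F = coeff (e (m ℕ.+ k))} (λ _ → refl) (p ∘ (k ∷_)) α))

𝒞-column : ∀ {K} m F → degree F < K → coeff (𝒞 m F) ≗ column K m (coeff F)
𝒞-column {K} m F lt α = begin
  coeff (𝒞 m F) α              ≡⟨ ∑Λ-coeff (upTo (suc (degree F))) (λ k → sign k • (e (m ℕ.+ k) *Λ 𝒯 k F)) α ⟩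
  ∑ (upTo (suc (degree F))) term ≡⟨ ∑-upTo (suc (degree F)) term ⟩
  Σ< (suc (degree F)) term     ≡⟨ Σ<-extend lt term high ⟨
  Σ< K term                    ∎
  where
  open ≡-Reasoning
  term : ℕ → ℚ
  term k = sign k * (coeff (e (m ℕ.+ k)) ⊛ (coeff F ∘ (k ∷_))) α
  high : ∀ k → degree F < k → term k ≡ 0ℚ
  high k lt = *0 (sign k) (⊛-zeroʳ (coeff (e (m ℕ.+ k))) (coeff F ∘ (k ∷_)) (𝒯-high F lt) α)

𝒞-cong : ∀ m {F G} → F ≈ G → 𝒞 m F ≈ 𝒞 m G
𝒞-cong m {F} {G} p α = begin
  coeff (𝒞 m F) α        ≡⟨ 𝒞-column m F (s≤s (ℕ.m≤m⊔n (degree F) (degree G))) α ⟩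
  column K m (coeff F) α ≡⟨ column-cong K m p α ⟩
  column K m (coeff G) α ≡⟨ 𝒞-column m G (s≤s (ℕ.m≤n⊔m (degree F) (degree G))) α ⟨
  coeff (𝒞 m G) α        ∎
  where
  open ≡-Reasoning
  K = suc (degree F ℕ.⊔ degree G)

𝒞-zero : ∀ m F → F ≈ 0Λ → 𝒞 m F ≈ 0Λ
𝒞-zero m F p α = trans (𝒞-column m F (ℕ.n<1+n (degree F)) α)
  (Σ<-zero (suc (degree F)) (λ k →
    *0 (sign k) (⊛-zeroʳ (coeff (e (m ℕ.+ k))) (coeff F ∘ (k ∷_)) (p ∘ (k ∷_)) α)))

column-+ : ∀ K m F G α →
           column K m (λ γ → F γ + G γ) α ≡ column K m F α + column K m G α
column-+ K m F G α = trans
  (Σ<-cong K (λ k → trans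
    (cong (sign k *_) (⊛-+ʳ (coeff (e (m ℕ.+ k))) (F ∘ (k ∷_)) (G ∘ (k ∷_)) α))
    (ℚ.*-distribˡ-+ (sign k) _ _)))
  (Σ<-+ K _ _)

column-* : ∀ K m q F α → column K m (λ γ → q * F γ) α ≡ q * column K m F α
column-* K m q F α = trans
  (Σ<-cong K (λ k → trans
    (cong (sign k *_) (⊛-*ʳ (coeff (e (m ℕ.+ k))) q (F ∘ (k ∷_)) α))
    (*-leftComm (sign k) q _)))
  (sym (Σ<-* K q _))

𝒞-+ : ∀ m F G → 𝒞 m (F +Λ G) ≈ 𝒞 m F +Λ 𝒞 m G
𝒞-+ m F G α = begin
  coeff (𝒞 m (F +Λ G)) α        ≡⟨ 𝒞-column m (F +Λ G) (ℕ.n<1+n (degree F ℕ.⊔ degree G)) α ⟩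
  column K m (coeff (F +Λ G)) α ≡⟨ column-+ K m (coeff F) (coeff G) α ⟩
  column K m (coeff F) α + column K m (coeff G) α
    ≡⟨ cong₂ _+_ (𝒞-column m F (s≤s (ℕ.m≤m⊔n (degree F) (degree G))) α)
                 (𝒞-column m G (s≤s (ℕ.m≤n⊔m (degree F) (degree G))) α) ⟨
  coeff (𝒞 m F) α + coeff (𝒞 m G) α ∎
  where
  open ≡-Reasoning
  K = suc (degree F ℕ.⊔ degree G)

𝒞-• : ∀ m q F → 𝒞 m (q • F) ≈ q • 𝒞 m F
𝒞-• m q F α = begin
  coeff (𝒞 m (q • F)) α        ≡⟨ 𝒞-column m (q • F) (ℕ.n<1+n (degree F)) α ⟩
  column K m (coeff (q • F)) α ≡⟨ column-* K m q (coeff F) α ⟩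
  q * column K m (coeff F) α   ≡⟨ cong (q *_) (𝒞-column m F (ℕ.n<1+n (degree F)) α) ⟨
  q * coeff (𝒞 m F) α          ∎
  where
  open ≡-Reasoning
  K = suc (degree F)

𝒞-∑ : ∀ {A : Set} m xs (q : A → ℚ) (F : A → Λ) α →
      coeff (𝒞 m (∑Λ xs (λ x → q x • F x))) α ≡ ∑ xs (λ x → q x * coeff (𝒞 m (F x)) α)
𝒞-∑ m []       q F α = 𝒞-zero m 0Λ (λ _ → refl) α
𝒞-∑ m (x ∷ xs) q F α = trans
  (𝒞-+ m (q x • F x) (∑Λ xs (λ x → q x • F x)) α)
  (cong₂ _+_ (𝒞-• m (q x) (F x) α) (𝒞-∑ m xs q F α))

𝒞-1 : 𝒞 0 1Λ ≈ 1Λ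
𝒞-1 α = begin
  coeff (𝒞 0 1Λ) α                         ≡⟨ 𝒞-column {1} 0 1Λ (s≤s z≤n) α ⟩
  1ℚ * (coeff (e 0) ⊛ coeff 1Λ) α + 0ℚ     ≡⟨ ℚ.+-identityʳ (1ℚ * (coeff (e 0) ⊛ coeff 1Λ) α) ⟩
  1ℚ * (coeff (e 0) ⊛ coeff 1Λ) α          ≡⟨ ℚ.*-identityˡ ((coeff (e 0) ⊛ coeff 1Λ) α) ⟩
  (coeff (e 0) ⊛ coeff 1Λ) α               ≡⟨ ⊛-cong {G = coeff 1Λ} e0≈1 (λ _ → refl) α ⟩
  (coeff 1Λ ⊛ coeff 1Λ) α                  ≡⟨ ⊛-identityˡ 1Λ α ⟩
  coeff 1Λ α                               ∎
  where open ≡-Reasoning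

-- A column operator of positive height has no constant term.
𝒞-[] : ∀ m F → coeff (𝒞 (suc m) F) [] ≡ 0ℚ
𝒞-[] m F = trans (𝒞-column (suc m) F (ℕ.n<1+n (degree F)) [])
  (Σ<-zero (suc (degree F)) (λ k → *0 (sign k) (0* (coeff F (k ∷ [])) (e-[] (m ℕ.+ k)))))

𝒯₀-𝒞 : ∀ m F α → coeff (𝒞 m F) (0 ∷ α) ≡ coeff (𝒞 m (𝒯 0 F)) α
𝒯₀-𝒞 m F α = trans (coeff-0∷ (𝒞 m F) α) (𝒞-cong m {F} {𝒯 0 F} (λ β → sym (coeff-0∷ F β)) α)

-- The relation 𝒯(u) C(z) = (1 - uz) C(z) 𝒯(u), coefficientwise.  It reflects that
-- 𝒯(u) multiplies the product of all (1 - xz) by (1 - uz).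
𝒯-𝒞 : ∀ m a F α → coeff (𝒞 (suc m) F) (suc a ∷ α) ≡
      coeff (𝒞 (suc m) (𝒯 (suc a) F)) α + coeff (𝒞 m (𝒯 a F)) α
𝒯-𝒞 m a F α = go (suc (degree F)) (ℕ.n<1+n (degree F))
  where
  open ≡-Reasoning
  split : ∀ k → (coeff (e (suc m ℕ.+ k)) ⊛ (coeff F ∘ (k ∷_))) (suc a ∷ α) ≡
          (coeff (e (suc m ℕ.+ k)) ⊛ (coeff (𝒯 (suc a) F) ∘ (k ∷_))) α +
          (coeff (e (m ℕ.+ k)) ⊛ (coeff (𝒯 a F) ∘ (k ∷_))) α
  split k = cong₂ _+_
    (⊛-cong (coeff-0∷ (e (suc m ℕ.+ k))) (𝒯-comm k (suc a) F) α)
    (trans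
      (⨁-first a (λ i j →
         ((coeff (e (suc m ℕ.+ k)) ∘ (suc i ∷_)) ⊛ (coeff F ∘ (k ∷_) ∘ (j ∷_))) α)
        (λ i j → ⊛-zeroˡ _ (coeff F ∘ (k ∷_) ∘ (j ∷_)) (e-2∷ (suc m ℕ.+ k) i) α))
      (⊛-cong (e-1∷ (m ℕ.+ k)) (𝒯-comm k a F) α))
  go : ∀ K → degree F < K → coeff (𝒞 (suc m) F) (suc a ∷ α) ≡
       coeff (𝒞 (suc m) (𝒯 (suc a) F)) α + coeff (𝒞 m (𝒯 a F)) α
  go K lt = begin
    coeff (𝒞 (suc m) F) (suc a ∷ α)
      ≡⟨ 𝒞-column (suc m) F lt (suc a ∷ α) ⟩
    column K (suc m) (coeff F) (suc a ∷ α)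
      ≡⟨ Σ<-cong K (λ k → trans (cong (sign k *_) (split k)) (ℚ.*-distribˡ-+ (sign k) _ _)) ⟩
    Σ< K (λ k →
      sign k * (coeff (e (suc m ℕ.+ k)) ⊛ (coeff (𝒯 (suc a) F) ∘ (k ∷_))) α +
      sign k * (coeff (e (m ℕ.+ k)) ⊛ (coeff (𝒯 a F) ∘ (k ∷_))) α)
      ≡⟨ Σ<-+ K _ _ ⟩
    column K (suc m) (coeff (𝒯 (suc a) F)) α + column K m (coeff (𝒯 a F)) α
      ≡⟨ cong₂ _+_ (𝒞-column (suc m) (𝒯 (suc a) F) lt α) (𝒞-column m (𝒯 a F) lt α) ⟨
    coeff (𝒞 (suc m) (𝒯 (suc a) F)) α + coeff (𝒞 m (𝒯 a F)) α ∎

-- The case n = m + 1 of the relation C m ∘ C n = - C (n-1) ∘ C (m+1): in the double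
-- sum for C m ∘ C (m+1), exchanging the two summation indices changes the sign.
𝒞-𝒞 : ∀ m F → 𝒞 m (𝒞 (suc m) F) ≈ 0Λ
𝒞-𝒞 m F α = exchange (suc (degree F ℕ.⊔ degree (𝒞 (suc m) F)))
  (s≤s (ℕ.m≤m⊔n (degree F) _)) (s≤s (ℕ.m≤n⊔m (degree F) _))
  where
  open ≡-Reasoning
  G = 𝒞 (suc m) F
  E A B : ℕ → Series
  E k = coeff (e (m ℕ.+ k))
  A k = coeff (𝒞 (suc m) (𝒯 k F))
  B k = coeff (𝒞 m (𝒯 k F))
  -- The terms of the two double sums that result from expanding A and B.
  Z : ℚ → Series → ℕ → ℕ → ℕ → ℚ
  Z q H n k l = q * (sign l * (H ⊛ (coeff (e (n ℕ.+ l)) ⊛ (coeff F ∘ (k ∷_) ∘ (l ∷_)))) α)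
  X Y : ℕ → ℕ → ℚ
  X k l = Z (sign k) (E k) (suc m) k l
  Y k l = Z (sign (suc k)) (E (suc k)) m k l
  -- Y l k differs from X k l by the order of the two elementary functions and the sign.
  cancel : ∀ k l → X k l + Y l k ≡ 0ℚ
  cancel k l = begin
    X k l + Y l k
      ≡⟨ cong (λ q → X k l + - sign l * (sign k * q)) (trans
           (⊛-cong (λ γ → cong (λ n → coeff (e n) γ) (ℕ.+-suc m l))
             (⊛-cong {F = E k} (λ _ → refl) (𝒯-comm l k F)) α)
           (⊛-leftComm (coeff (e (suc m ℕ.+ l))) (E k) (coeff F ∘ (k ∷_) ∘ (l ∷_)) α)) ⟩
    X k l + - sign l * (sign k * (E k ⊛ (coeff (e (suc m ℕ.+ l)) ⊛ (coeff F ∘ (k ∷_) ∘ (l ∷_)))) α)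
      ≡⟨ antisym (sign k) (sign l) _ ⟩
    0ℚ ∎
    where
    antisym : ∀ a b c → a * (b * c) + - b * (a * c) ≡ 0ℚ
    antisym = solve 3 (λ a b c → a :* (b :* c) :+ (:- b) :* (a :* c) := con 0ℚ) refl
      where open +-*-Solver
  module _ (K : ℕ) (F<K : degree F < K) (G<K : degree G < K) where
    Bs : ℚ
    Bs = Σ< K (λ k → sign (suc k) * (E (suc k) ⊛ B k) α)
    expand : ∀ q H n k → q * (H ⊛ coeff (𝒞 n (𝒯 k F))) α ≡ Σ< K (Z q H n k)
    expand q H n k = begin
      q * (H ⊛ coeff (𝒞 n (𝒯 k F))) α
        ≡⟨ cong (q *_) (⊛-cong {F = H} (λ _ → refl)
             (𝒞-column n (𝒯 k F) F<K) α) ⟩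
      q * (H ⊛ column K n (coeff (𝒯 k F))) α
        ≡⟨ cong (q *_) (⊛-Σ<ʳ H K _ α) ⟩
      q * Σ< K (λ l → (H ⊛ (λ γ → sign l *
        (coeff (e (n ℕ.+ l)) ⊛ (coeff F ∘ (k ∷_) ∘ (l ∷_))) γ)) α)
        ≡⟨ cong (q *_) (Σ<-cong K (λ l → ⊛-*ʳ H (sign l) _ α)) ⟩
      q * Σ< K (λ l → sign l * (H ⊛ (coeff (e (n ℕ.+ l)) ⊛ (coeff F ∘ (k ∷_) ∘ (l ∷_)))) α)
        ≡⟨ Σ<-* K q _ ⟩
      Σ< K (Z q H n k) ∎
    -- By 𝒯-𝒞 the term of index k + 1 of 𝒞 m G splits into A (k+1), which continues the
    -- sum begun by A 0, and B k, whose sum has its index shifted by one.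
    exchange : coeff (𝒞 m G) α ≡ 0ℚ
    exchange = begin
      coeff (𝒞 m G) α
        ≡⟨ 𝒞-column m G (ℕ.m≤n⇒m≤1+n G<K) α ⟩
      1ℚ * (E 0 ⊛ (coeff G ∘ (0 ∷_))) α +
      Σ< K (λ k → sign (suc k) * (E (suc k) ⊛ (coeff G ∘ (suc k ∷_))) α)
        ≡⟨ cong₂ _+_
             (cong (1ℚ *_) (⊛-cong {F = E 0} (λ _ → refl) (𝒯₀-𝒞 (suc m) F) α))
             (Σ<-cong K (λ k → trans
               (cong (sign (suc k) *_) (trans
                 (⊛-cong {F = E (suc k)} (λ _ → refl) (𝒯-𝒞 m k F) α)
                 (⊛-+ʳ (E (suc k)) (A (suc k)) (B k) α)))
               (ℚ.*-distribˡ-+ (sign (suc k)) _ _))) ⟩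
      1ℚ * (E 0 ⊛ A 0) α + Σ< K (λ k → sign (suc k) * (E (suc k) ⊛ A (suc k)) α +
                                       sign (suc k) * (E (suc k) ⊛ B k) α)
        ≡⟨ cong (1ℚ * (E 0 ⊛ A 0) α +_) (Σ<-+ K _ _) ⟩
      1ℚ * (E 0 ⊛ A 0) α + (Σ< K (λ k → sign (suc k) * (E (suc k) ⊛ A (suc k)) α) + Bs)
        ≡⟨ ℚ.+-assoc (1ℚ * (E 0 ⊛ A 0) α) _ _ ⟨
      Σ< (suc K) (λ k → sign k * (E k ⊛ A k) α) + Bs
        ≡⟨ cong (_+ Bs) (Σ<-extend (ℕ.n≤1+n K) _ (λ k K≤k → *0 (sign k)
             (⊛-zeroʳ (E k) (A k) (𝒞-zero (suc m) (𝒯 k F)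
               (𝒯-high F (ℕ.<-≤-trans F<K K≤k))) α))) ⟩
      Σ< K (λ k → sign k * (E k ⊛ A k) α) + Bs
        ≡⟨ cong₂ _+_
             (Σ<-cong K (λ k → expand (sign k) (E k) (suc m) k))
             (trans (Σ<-cong K (λ k → expand (sign (suc k)) (E (suc k)) m k)) (Σ<-swap K K Y)) ⟩
      Σ< K (λ k → Σ< K (X k)) + Σ< K (λ k → Σ< K (λ l → Y l k))
        ≡⟨ Σ<-+ K (λ k → Σ< K (X k)) (λ k → Σ< K (λ l → Y l k)) ⟨
      Σ< K (λ k → Σ< K (X k) + Σ< K (λ l → Y l k))
        ≡⟨ Σ<-zero K (λ k → trans (sym (Σ<-+ K (X k) (λ l → Y l k))) (Σ<-zero K (cancel k))) ⟩
      0ℚ ∎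

-- Schur functions

-- The number of parts of l that exceed j, which is the height of column j.
height : List ℕ → ℕ → ℕ
height l j = length (filter (j ℕ.<?_) l)

-- The parts of the conjugate of l.
columns : List ℕ → List ℕ
columns l = applyUpTo (height l) (first l)

-- The result of building the given columns, the last one first, starting from 1.
𝒞s : List ℕ → Λ
𝒞s = foldr 𝒞 1Λ

-- The Schur function of shape l, built column by column.  It is defined for all lists l;
-- it is meaningful for weakly decreasing ones, which may have zero parts.
𝒮 : List ℕ → Λ
𝒮 l = 𝒞s (columns l)

applyUpTo-cong : ∀ {f g : ℕ → ℕ} n → (∀ j → j < n → f j ≡ g j) → applyUpTo f n ≡ applyUpTo g n
applyUpTo-cong zero    p = refl
applyUpTo-cong (suc n) p = cong₂ _∷_ (p 0 (s≤s z≤n)) (applyUpTo-cong n (λ j lt → p (suc j) (s≤s lt)))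

height-suc-0 : ∀ l → height (map suc l) 0 ≡ length l
height-suc-0 []      = refl
height-suc-0 (x ∷ l) = cong suc (height-suc-0 l)

height-suc : ∀ l j → height (map suc l) (suc j) ≡ height l j
height-suc []      j = refl
height-suc (x ∷ l) j with j ℕ.<ᵇ x
... | true  = cong suc (height-suc l j)
... | false = height-suc l j

height-∷ʳ0 : ∀ l j → height (l ∷ʳ 0) j ≡ height l j
height-∷ʳ0 []      j = refl
height-∷ʳ0 (x ∷ l) j with j ℕ.<ᵇ x
... | true  = cong suc (height-∷ʳ0 l j)
... | false = height-∷ʳ0 l j

first-∷ʳ0 : ∀ l → first (l ∷ʳ 0) ≡ first l
first-∷ʳ0 []      = refl
first-∷ʳ0 (x ∷ l) = refl

-- Adding a full column in front.
𝒮-suc : ∀ l → 𝒮 (map suc l) ≈ 𝒞 (length l) (𝒮 l)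
𝒮-suc []        α = sym (𝒞-1 α)
𝒮-suc l@(x ∷ _) α = cong (λ cs → coeff (𝒞s cs) α)
  (cong₂ _∷_ (height-suc-0 l) (applyUpTo-cong x (λ j _ → height-suc l j)))

𝒮-∷ʳ0 : ∀ l → 𝒮 (l ∷ʳ 0) ≈ 𝒮 l
𝒮-∷ʳ0 l α = cong (λ cs → coeff (𝒞s cs) α) (trans
  (cong (applyUpTo (height (l ∷ʳ 0))) (first-∷ʳ0 l))
  (applyUpTo-cong (first l) (λ j _ → height-∷ʳ0 l j)))

-- A weakly decreasing list, possibly with zero parts, arises from the empty list
-- by adding full columns and empty bottom rows.
data Shape : List ℕ → Set where
  empty  : Shape []
  column₊ : ∀ {x l} → Shape (x ∷ l) → Shape (map suc (x ∷ l))
  row₀   : ∀ {l} → Shape l → Shape (l ∷ʳ 0)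

Shape-∷ : ∀ {x l} → first l ≤ x → Shape l → Shape (x ∷ l)
Shape-∷ {zero}  _        empty      = row₀ empty
Shape-∷ {suc x} _        empty      = column₊ (Shape-∷ {x} z≤n empty)
Shape-∷ {suc x} (s≤s le) (column₊ S) = column₊ (Shape-∷ le S)
Shape-∷ {x}     le       (row₀ {l} S) = row₀ (Shape-∷ (subst (_≤ x) (first-∷ʳ0 l) le) S)

Linked⇒Shape : ∀ {l} → Linked _≥_ l → Shape l
Linked⇒Shape []       = empty
Linked⇒Shape [-]      = Shape-∷ z≤n empty
Linked⇒Shape (p ∷ ps) = Shape-∷ p (Linked⇒Shape ps)

sum-map-suc : ∀ l → sum (map suc l) ≡ sum l ℕ.+ length l
sum-map-suc []      = refl
sum-map-suc (x ∷ l) = begin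
  suc (x ℕ.+ sum (map suc l))         ≡⟨ cong (λ n → suc (x ℕ.+ n)) (sum-map-suc l) ⟩
  suc (x ℕ.+ (sum l ℕ.+ length l))    ≡⟨ cong suc (ℕ.+-assoc x (sum l) (length l)) ⟨
  suc ((x ℕ.+ sum l) ℕ.+ length l)    ≡⟨ ℕ.+-suc (x ℕ.+ sum l) (length l) ⟨
  (x ℕ.+ sum l) ℕ.+ suc (length l)    ∎
  where open ≡-Reasoning

𝒮-[] : ∀ {l} → Shape l → coeff (𝒮 l) [] ≡ ⟦ sum l ℕ.≟ 0 ⟧
𝒮-[] empty              = refl
𝒮-[] (column₊ {x} {l} S) = trans (𝒮-suc (x ∷ l) []) (𝒞-[] (length l) (𝒮 (x ∷ l)))
𝒮-[] (row₀ {l} S)       = trans (𝒮-∷ʳ0 l []) (trans (𝒮-[] S)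
  (cong (λ n → ⟦ n ℕ.≟ 0 ⟧) (sym (sum-∷ʳ0 l))))

-- Horizontal strips

-- What is needed of the lists m enumerated by strips l.
record IsStrip (l m : List ℕ) : Set where
  field
    shape    : Shape m
    first-≤  : first m ≤ first l
    length-≡ : length m ≡ length l
    sum-≤    : sum m ≤ sum l

strips-All : ∀ l → All (IsStrip l) (strips l)
strips-All []      = record { shape = empty ; first-≤ = z≤n ; length-≡ = refl ; sum-≤ = z≤n } ∷ []
strips-All (x ∷ l) = All.cartesianProductWith⁺ (setoid ℕ) (setoid (List ℕ)) _∷_ _ (strips l) add
  where
  above : ∀ lo {hi i} → i < suc hi ℕ.∸ lo → lo ℕ.+ i ≤ hi
  above zero              (s≤s le) = le
  above (suc lo) {suc hi} lt       = s≤s (above lo lt)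
  above (suc lo) {zero} {i} lt       =
    contradiction (subst (i <_) (ℕ.0∸n≡0 lo) lt) (λ ())
  add : ∀ {y m} → y ∈ map (first l ℕ.+_) (upTo (suc x ℕ.∸ first l)) → m ∈ strips l →
        IsStrip (x ∷ l) (y ∷ m)
  add y∈ m∈ with ∈-map⁻ (first l ℕ.+_) y∈
  ... | i , i∈ , refl = record
    { shape    = Shape-∷ (ℕ.≤-trans first-≤ (ℕ.m≤m+n (first l) i)) shape
    ; first-≤  = y≤x
    ; length-≡ = cong suc length-≡
    ; sum-≤    = ℕ.+-mono-≤ y≤x sum-≤
    }
    where
    open IsStrip (All.lookup (strips-All l) m∈)
    y≤x = above (first l) (∈-upTo⁻ i∈)

-- The value of t at the strip obtained from m by adding 1 to all parts but the last,
-- if the last part of m is zero.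
bottom : (List ℕ → ℚ) → List ℕ → ℚ
bottom t []           = 0ℚ
bottom t (x ∷ y ∷ m)  = bottom (t ∘ (suc x ∷_)) (y ∷ m)
bottom t (zero ∷ [])  = t (0 ∷ [])
bottom t (suc _ ∷ []) = 0ℚ

bottom-row₀ : ∀ t m → bottom t (m ∷ʳ 0) ≡ t (map suc m ∷ʳ 0)
bottom-row₀ t []          = refl
bottom-row₀ t (x ∷ [])    = refl
bottom-row₀ t (x ∷ y ∷ m) = bottom-row₀ (t ∘ (suc x ∷_)) (y ∷ m)

bottom-column₊ : ∀ t x m → bottom t (map suc (x ∷ m)) ≡ 0ℚ
bottom-column₊ t x []      = refl
bottom-column₊ t x (y ∷ m) = bottom-column₊ (t ∘ (suc (suc x) ∷_)) y m

bottom-∷ : ∀ t x m {k} → length m ≡ suc k → bottom t (x ∷ m) ≡ bottom (t ∘ (suc x ∷_)) m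
bottom-∷ t x (y ∷ m) _ = refl

-- The strips of a shape with positive parts either keep the whole first column or
-- lack its lowest cell.
strips-suc : ∀ x l (t : List ℕ → ℚ) →
  ∑ (strips (map suc (x ∷ l))) t ≡ ∑ (strips (x ∷ l)) (λ m → t (map suc m) + bottom t m)
strips-suc x [] t = begin
  ∑ (strips (suc x ∷ [])) t
    ≡⟨ single (suc x) t ⟩
  t (0 ∷ []) + Σ< (suc x) (λ i → t (suc i ∷ []))
    ≡⟨ ℚ.+-comm (t (0 ∷ [])) _ ⟩
  Σ< (suc x) (λ i → t (suc i ∷ [])) + t (0 ∷ [])
    ≡⟨ cong (Σ< (suc x) (λ i → t (suc i ∷ [])) +_) (+0 (t (0 ∷ [])) (Σ<-zero x (λ _ → refl))) ⟨
  Σ< (suc x) (λ i → t (suc i ∷ [])) + Σ< (suc x) (λ i → bottom t (i ∷ []))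
    ≡⟨ Σ<-+ (suc x) (λ i → t (suc i ∷ [])) (λ i → bottom t (i ∷ [])) ⟨
  Σ< (suc x) (λ i → t (suc i ∷ []) + bottom t (i ∷ []))
    ≡⟨ single x (λ m → t (map suc m) + bottom t m) ⟨
  ∑ (strips (x ∷ [])) (λ m → t (map suc m) + bottom t m) ∎
  where
  open ≡-Reasoning
  single : ∀ x (t : List ℕ → ℚ) → ∑ (strips (x ∷ [])) t ≡ Σ< (suc x) (λ i → t (i ∷ []))
  single x t = begin
    ∑ (strips (x ∷ [])) t ≡⟨ ∑-× _∷_ (map (0 ℕ.+_) (upTo (suc x))) ([] ∷ []) t ⟩
    ∑ (map (0 ℕ.+_) (upTo (suc x))) (λ i → t (i ∷ []) + 0ℚ)
      ≡⟨ ∑-map (0 ℕ.+_) (upTo (suc x)) (λ i → t (i ∷ []) + 0ℚ) ⟩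
    ∑ (upTo (suc x)) (λ i → t (i ∷ []) + 0ℚ)
      ≡⟨ ∑-cong (upTo (suc x)) (λ i → ℚ.+-identityʳ (t (i ∷ []))) ⟩
    ∑ (upTo (suc x)) (λ i → t (i ∷ []))
      ≡⟨ ∑-upTo (suc x) (λ i → t (i ∷ [])) ⟩
    Σ< (suc x) (λ i → t (i ∷ [])) ∎
strips-suc x (y ∷ l) t = begin
  ∑ (strips (map suc (x ∷ y ∷ l))) t
    ≡⟨ trans (∑-× _∷_ (map (suc y ℕ.+_) (upTo n)) (strips (map suc (y ∷ l))) t)
         (∑-map (suc y ℕ.+_) (upTo n) (λ i → ∑ (strips (map suc (y ∷ l))) (t ∘ (i ∷_)))) ⟩
  ∑ (upTo n) (λ i → ∑ (strips (map suc (y ∷ l))) (λ m → t (suc (y ℕ.+ i) ∷ m)))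
    ≡⟨ ∑-cong (upTo n) (λ i → strips-suc y l (λ m → t (suc (y ℕ.+ i) ∷ m))) ⟩
  ∑ (upTo n) (λ i → ∑ (strips (y ∷ l)) (λ m →
    t (suc (y ℕ.+ i) ∷ map suc m) + bottom (λ m → t (suc (y ℕ.+ i) ∷ m)) m))
    ≡⟨ ∑-cong (upTo n) (λ i → ∑-cong-All (All.map
         (λ {m} st → cong (t (suc (y ℕ.+ i) ∷ map suc m) +_)
           (sym (bottom-∷ t (y ℕ.+ i) m (IsStrip.length-≡ st))))
         (strips-All (y ∷ l)))) ⟩
  ∑ (upTo n) (λ i → ∑ (strips (y ∷ l)) (λ m → u (y ℕ.+ i ∷ m)))
    ≡⟨ trans (∑-× _∷_ (map (y ℕ.+_) (upTo n)) (strips (y ∷ l)) u)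
         (∑-map (y ℕ.+_) (upTo n) (λ i → ∑ (strips (y ∷ l)) (u ∘ (i ∷_)))) ⟨
  ∑ (strips (x ∷ y ∷ l)) u ∎
  where
  open ≡-Reasoning
  n = suc x ℕ.∸ y
  u : List ℕ → ℚ
  u m = t (map suc m) + bottom t m

strips-∷ʳ0 : ∀ l → strips (l ∷ʳ 0) ≡ map (_∷ʳ 0) (strips l)
strips-∷ʳ0 []      = refl
strips-∷ʳ0 (x ∷ l) = trans
  (cong₂ (λ lo ms → cartesianProductWith _∷_ (map (lo ℕ.+_) (upTo (suc x ℕ.∸ lo))) ms)
    (first-∷ʳ0 l) (strips-∷ʳ0 l))
  (go (map (first l ℕ.+_) (upTo (suc x ℕ.∸ first l))))
  where
  go : ∀ ys → cartesianProductWith _∷_ ys (map (_∷ʳ 0) (strips l)) ≡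
              map (_∷ʳ 0) (cartesianProductWith _∷_ ys (strips l))
  go []       = refl
  go (y ∷ ys) = begin
    map (y ∷_) (map (_∷ʳ 0) (strips l)) ++ cartesianProductWith _∷_ ys (map (_∷ʳ 0) (strips l))
      ≡⟨ cong₂ _++_ (trans (sym (List.map-∘ (strips l))) (List.map-∘ (strips l))) (go ys) ⟩
    map (_∷ʳ 0) (map (y ∷_) (strips l)) ++ map (_∷ʳ 0) (cartesianProductWith _∷_ ys (strips l))
      ≡⟨ List.map-++ (_∷ʳ 0) (map (y ∷_) (strips l)) _ ⟨
    map (_∷ʳ 0) (map (y ∷_) (strips l) ++ cartesianProductWith _∷_ ys (strips l)) ∎
    where open ≡-Reasoning

-- 1 if m has a cells fewer than l, and 0 otherwise.
weight : ℕ → List ℕ → List ℕ → ℚ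
weight a l m = ⟦ sum m ℕ.+ a ℕ.≟ sum l ⟧

weight-suc : ∀ a l m → length m ≡ length l → weight a (map suc l) (map suc m) ≡ weight a l m
weight-suc a l m len = ⟦⟧-cong (sum (map suc m) ℕ.+ a ℕ.≟ sum (map suc l)) (sum m ℕ.+ a ℕ.≟ sum l)
  (λ p → ℕ.+-cancelʳ-≡ (length l) _ _ (trans (sym rearrange) (trans p (sum-map-suc l))))
  (λ p → trans rearrange (trans (cong (ℕ._+ length l) p) (sym (sum-map-suc l))))
  where
  rearrange : sum (map suc m) ℕ.+ a ≡ (sum m ℕ.+ a) ℕ.+ length l
  rearrange = begin
    sum (map suc m) ℕ.+ a            ≡⟨ cong (ℕ._+ a) (sum-map-suc m) ⟩
    (sum m ℕ.+ length m) ℕ.+ a       ≡⟨ ℕ.+-assoc (sum m) (length m) a ⟩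
    sum m ℕ.+ (length m ℕ.+ a)       ≡⟨ cong (sum m ℕ.+_) (ℕ.+-comm (length m) a) ⟩
    sum m ℕ.+ (a ℕ.+ length m)       ≡⟨ ℕ.+-assoc (sum m) a (length m) ⟨
    (sum m ℕ.+ a) ℕ.+ length m       ≡⟨ cong ((sum m ℕ.+ a) ℕ.+_) len ⟩
    (sum m ℕ.+ a) ℕ.+ length l       ∎
    where open ≡-Reasoning

-- If the horizontal strip of size a removed from a shape contains the lowest cell of the
-- first column, it has a - 1 cells in the other columns.
weight-bottom : ∀ a x l m → length m ≡ length l →
  weight a (map suc (x ∷ l)) (map suc m ∷ʳ 0) ≡ ⟦ sum m ℕ.+ a ℕ.≟ suc (sum (x ∷ l)) ⟧
weight-bottom a x l m len =
  ⟦⟧-cong (sum (map suc m ∷ʳ 0) ℕ.+ a ℕ.≟ sum (map suc (x ∷ l))) (sum m ℕ.+ a ℕ.≟ suc (sum (x ∷ l)))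
    (λ p → ℕ.+-cancelʳ-≡ (length l) _ _ (trans (sym rearrange) (trans p total)))
    (λ p → trans rearrange (trans (cong (ℕ._+ length l) p) (sym total)))
  where
  open ≡-Reasoning
  total : sum (map suc (x ∷ l)) ≡ suc (sum (x ∷ l)) ℕ.+ length l
  total = trans (sum-map-suc (x ∷ l)) (ℕ.+-suc (sum (x ∷ l)) (length l))
  rearrange : sum (map suc m ∷ʳ 0) ℕ.+ a ≡ (sum m ℕ.+ a) ℕ.+ length l
  rearrange = begin
    sum (map suc m ∷ʳ 0) ℕ.+ a       ≡⟨ cong (ℕ._+ a) (sum-∷ʳ0 (map suc m)) ⟩
    sum (map suc m) ℕ.+ a            ≡⟨ cong (ℕ._+ a) (sum-map-suc m) ⟩
    (sum m ℕ.+ length m) ℕ.+ a       ≡⟨ ℕ.+-assoc (sum m) (length m) a ⟩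
    sum m ℕ.+ (length m ℕ.+ a)       ≡⟨ cong (sum m ℕ.+_) (ℕ.+-comm (length m) a) ⟩
    sum m ℕ.+ (a ℕ.+ length m)       ≡⟨ ℕ.+-assoc (sum m) a (length m) ⟨
    (sum m ℕ.+ a) ℕ.+ length m       ≡⟨ cong ((sum m ℕ.+ a) ℕ.+_) len ⟩
    (sum m ℕ.+ a) ℕ.+ length l       ∎

-- The two kinds of strips in the shape obtained from L = x ∷ l by adding a full column.
-- Those that keep this column match the first summand of 𝒯-𝒞, the others the second.
module Branching (x : ℕ) (l : List ℕ) where

  L : List ℕ
  L = x ∷ l

  -- The summand of m in the branching rule for the larger shape.
  term : ℕ → List ℕ → List ℕ → ℚ
  term a α m = weight a (map suc L) m * coeff (𝒮 m) α

  keep : ∀ a α {m} → IsStrip L m →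
         term a α (map suc m) ≡ weight a L m * coeff (𝒞 (suc (length l)) (𝒮 m)) α
  keep a α {m} st = cong₂ _*_ (weight-suc a L m length-≡)
    (trans (𝒮-suc m α) (cong (λ k → coeff (𝒞 k (𝒮 m)) α) length-≡))
    where open IsStrip st

  -- A strip of size 0 contains no cell of the first column.
  drop-0 : ∀ α {m} → IsStrip L m → bottom (term 0 α) m ≡ 0ℚ
  drop-0 α st = go (IsStrip.shape st) (IsStrip.length-≡ st) (IsStrip.sum-≤ st)
    where
    go : ∀ {m} → Shape m → length m ≡ length L → sum m ≤ sum L → bottom (term 0 α) m ≡ 0ℚ
    go empty                ()
    go (column₊ {y} {m} S) len le = bottom-column₊ (term 0 α) y m
    go (row₀ {m} S)        len le = trans (bottom-row₀ (term 0 α) m) (0* _ (trans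
      (weight-bottom 0 x l m (ℕ.suc-injective (trans (sym (length-∷ʳ m)) len)))
      (⟦⟧-no (sum m ℕ.+ 0 ℕ.≟ suc (sum L)) (λ p → contradiction
        (subst (_≤ sum L) (trans (sum-∷ʳ0 m) (trans (sym (ℕ.+-identityʳ (sum m))) p)) le)
        ℕ.1+n≰n))))
      where
      length-∷ʳ : ∀ m → length (m ∷ʳ 0) ≡ suc (length m)
      length-∷ʳ m = trans (List.length-++ m) (ℕ.+-comm (length m) 1)

  -- A shape with positive parts contributes nothing, as C k ∘ C (k+1) vanishes.
  drop-suc : ∀ a α {m} → IsStrip L m →
             bottom (term (suc a) α) m ≡ weight a L m * coeff (𝒞 (length l) (𝒮 m)) α
  drop-suc a α st = go (IsStrip.shape st) (IsStrip.length-≡ st)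
    where
    go : ∀ {m} → Shape m → length m ≡ length L →
         bottom (term (suc a) α) m ≡ weight a L m * coeff (𝒞 (length l) (𝒮 m)) α
    go empty               ()
    go (column₊ {y} {m} S) len = trans (bottom-column₊ (term (suc a) α) y m)
      (sym (*0 (weight a L (map suc (y ∷ m))) (trans
        (𝒞-cong (length l) {𝒮 (map suc (y ∷ m))} {𝒞 (suc (length l)) (𝒮 (y ∷ m))} (λ β → trans (𝒮-suc (y ∷ m) β)
          (cong (λ k → coeff (𝒞 k (𝒮 (y ∷ m))) β)
            (trans (sym (List.length-map suc (y ∷ m))) len))) α)
        (𝒞-𝒞 (length l) (𝒮 (y ∷ m)) α))))
    go (row₀ {m} S)        len = trans (bottom-row₀ (term (suc a) α) m) (cong₂ _*_
      (trans (weight-bottom (suc a) x l m len′)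
        (⟦⟧-cong (sum m ℕ.+ suc a ℕ.≟ suc (sum L)) (sum (m ∷ʳ 0) ℕ.+ a ℕ.≟ sum L)
          (λ p → trans (cong (ℕ._+ a) (sum-∷ʳ0 m))
            (ℕ.suc-injective (trans (sym (ℕ.+-suc (sum m) a)) p)))
          (λ p → trans (ℕ.+-suc (sum m) a)
            (cong suc (trans (cong (ℕ._+ a) (sym (sum-∷ʳ0 m))) p)))))
      (begin
        coeff (𝒮 (map suc m ∷ʳ 0)) α          ≡⟨ 𝒮-∷ʳ0 (map suc m) α ⟩
        coeff (𝒮 (map suc m)) α               ≡⟨ 𝒮-suc m α ⟩
        coeff (𝒞 (length m) (𝒮 m)) α          ≡⟨ cong (λ k → coeff (𝒞 k (𝒮 m)) α) len′ ⟩
        coeff (𝒞 (length l) (𝒮 m)) α          ≡⟨ 𝒞-cong (length l) {𝒮 (m ∷ʳ 0)} {𝒮 m} (𝒮-∷ʳ0 m) α ⟨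
        coeff (𝒞 (length l) (𝒮 (m ∷ʳ 0))) α   ∎))
      where
      open ≡-Reasoning
      len′ : length m ≡ length l
      len′ = ℕ.suc-injective (trans (ℕ.+-comm 1 (length m)) (trans (sym (List.length-++ m)) len))

-- The branching rule: 𝒯 a maps the Schur function of shape l to the sum of those of
-- the shapes m for which l/m is a horizontal strip of size a.
𝒮-branching : ∀ {l} → Shape l → ∀ a α →
  coeff (𝒮 l) (a ∷ α) ≡ ∑ (strips l) (λ m → weight a l m * coeff (𝒮 m) α)
𝒮-branching empty zero α =
  sym (trans (ℚ.+-identityʳ (1ℚ * coeff 1Λ α)) (ℚ.*-identityˡ (coeff 1Λ α)))
𝒮-branching empty (suc a) α = sym (0+0 (ℚ.*-zeroˡ (coeff 1Λ α)) refl)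
𝒮-branching (row₀ {l} S) a α = begin
  coeff (𝒮 (l ∷ʳ 0)) (a ∷ α)
    ≡⟨ 𝒮-∷ʳ0 l (a ∷ α) ⟩
  coeff (𝒮 l) (a ∷ α)
    ≡⟨ 𝒮-branching S a α ⟩
  ∑ (strips l) (λ m → weight a l m * coeff (𝒮 m) α)
    ≡⟨ ∑-cong (strips l) (λ m → cong₂ _*_
         (cong₂ (λ i j → ⟦ i ℕ.+ a ℕ.≟ j ⟧) (sum-∷ʳ0 m) (sum-∷ʳ0 l)) (𝒮-∷ʳ0 m α)) ⟨
  ∑ (strips l) (λ m → weight a (l ∷ʳ 0) (m ∷ʳ 0) * coeff (𝒮 (m ∷ʳ 0)) α)
    ≡⟨ ∑-map (_∷ʳ 0) (strips l) (λ m → weight a (l ∷ʳ 0) m * coeff (𝒮 m) α) ⟨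
  ∑ (map (_∷ʳ 0) (strips l)) (λ m → weight a (l ∷ʳ 0) m * coeff (𝒮 m) α)
    ≡⟨ cong (λ ms → ∑ ms (λ m → weight a (l ∷ʳ 0) m * coeff (𝒮 m) α)) (strips-∷ʳ0 l) ⟨
  ∑ (strips (l ∷ʳ 0)) (λ m → weight a (l ∷ʳ 0) m * coeff (𝒮 m) α) ∎
  where open ≡-Reasoning
𝒮-branching (column₊ {x} {l} S) a α = trans (peel a) (sym (begin
  ∑ (strips (map suc L)) (term a α)
    ≡⟨ strips-suc x l (term a α) ⟩
  ∑ (strips L) (λ m → term a α (map suc m) + bottom (term a α) m)
    ≡⟨ ∑-+ (strips L) (term a α ∘ map suc) (bottom (term a α)) ⟩
  ∑ (strips L) (term a α ∘ map suc) + ∑ (strips L) (bottom (term a α))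
    ≡⟨ cong (_+ ∑ (strips L) (bottom (term a α)))
         (∑-cong-All (All.map (keep a α) (strips-All L))) ⟩
  kept a + ∑ (strips L) (bottom (term a α)) ∎))
  where
  open ≡-Reasoning
  open Branching x l
  k = suc (length l)
  kept : ℕ → ℚ
  kept a = ∑ (strips L) (λ m → weight a L m * coeff (𝒞 k (𝒮 m)) α)
  through : ∀ n a → coeff (𝒞 n (𝒯 a (𝒮 L))) α ≡ ∑ (strips L) (λ m → weight a L m * coeff (𝒞 n (𝒮 m)) α)
  through n a = trans
    (𝒞-cong n {𝒯 a (𝒮 L)} {∑Λ (strips L) (λ m → weight a L m • 𝒮 m)}
      (λ β → trans (𝒮-branching S a β) (sym (∑Λ-coeff (strips L) (λ m → weight a L m • 𝒮 m) β))) α)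
    (𝒞-∑ n (strips L) (weight a L) 𝒮 α)
  peel : ∀ a → coeff (𝒮 (map suc L)) (a ∷ α) ≡ kept a + ∑ (strips L) (bottom (term a α))
  peel zero = begin
    coeff (𝒮 (map suc L)) (0 ∷ α)       ≡⟨ 𝒮-suc L (0 ∷ α) ⟩
    coeff (𝒞 k (𝒮 L)) (0 ∷ α)           ≡⟨ 𝒯₀-𝒞 k (𝒮 L) α ⟩
    coeff (𝒞 k (𝒯 0 (𝒮 L))) α           ≡⟨ through k 0 ⟩
    kept 0                              ≡⟨ +0 (kept 0) (∑-zero (All.map (drop-0 α) (strips-All L))) ⟨
    kept 0 + ∑ (strips L) (bottom (term 0 α)) ∎
  peel (suc a) = begin
    coeff (𝒮 (map suc L)) (suc a ∷ α)   ≡⟨ 𝒮-suc L (suc a ∷ α) ⟩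
    coeff (𝒞 k (𝒮 L)) (suc a ∷ α)       ≡⟨ 𝒯-𝒞 (length l) a (𝒮 L) α ⟩
    coeff (𝒞 k (𝒯 (suc a) (𝒮 L))) α + coeff (𝒞 (length l) (𝒯 a (𝒮 L))) α
      ≡⟨ cong₂ _+_ (through k (suc a)) (trans (through (length l) a)
           (∑-cong-All (All.map (λ st → sym (drop-suc a α st)) (strips-All L)))) ⟩
    kept (suc a) + ∑ (strips L) (bottom (term (suc a) α)) ∎

-- The tableaux of shape l are counted by the recursion of the branching rule.
𝒮-tableaux : ∀ {l} → Shape l → ∀ w → coeff (𝒮 l) w ≡ tableaux w l
𝒮-tableaux S []      = 𝒮-[] S
𝒮-tableaux {l} S (a ∷ w) = trans (𝒮-branching S a w) (∑-cong-All (All.map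
  (λ {m} st → cong (weight a l m *_) (𝒮-tableaux (IsStrip.shape st) w)) (strips-All l)))

-- The Schur function of a partition, as an element of Λ.
schur : Partition → Λ
schur p = 𝒮 (parts p)

-- The tableau generating function lists the variables in reverse order, which does not
-- matter as 𝒮 is symmetric by construction.
schur-s : ∀ p α → coeff (schur p) α ≡ s p α
schur-s p α = trans (symmetric (schur p) (↭-sym (↭-reverse α)))
  (𝒮-tableaux (Linked⇒Shape (decreasing p)) (reverse α))

-- Triangularity of the Schur functions

height-above : ∀ {l} → Linked _≥_ l → ∀ j → first l ≤ j → height l j ≡ 0
height-above []       j le = refl
height-above [-]      j le = cong length (List.filter-reject (j ℕ.<?_) (ℕ.≤⇒≯ le))
height-above (p ∷ ps) j le = trans
  (cong length (List.filter-reject (j ℕ.<?_) (ℕ.≤⇒≯ le)))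
  (height-above ps j (ℕ.≤-trans p le))

columns-∷ : ∀ x l → columns (x ∷ l) ≡ map suc (applyUpTo (height l) x)
columns-∷ x l = trans
  (applyUpTo-cong x (λ j j<x → cong length (List.filter-accept (j ℕ.<?_) j<x)))
  (sym (List.map-applyUpTo (height l) suc x))

-- 𝒯 a removes one cell from each of a distinct columns: there is no way to do so if a
-- exceeds the number of columns, and a single one if a equals it.
𝒞s-high : ∀ cs {a} → length cs < a → ∀ α → coeff (𝒞s (map suc cs)) (a ∷ α) ≡ 0ℚ
𝒞s-high []                 lt       α = h-high lt α
𝒞s-high (c ∷ cs) {suc a} (s≤s lt) α = trans
  (𝒯-𝒞 c a F α)
  (0+0 (𝒞-zero (suc c) (𝒯 (suc a) F) (𝒞s-high cs (ℕ.m≤n⇒m≤1+n lt)) α)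
       (𝒞-zero c (𝒯 a F) (𝒞s-high cs lt) α))
  where F = 𝒞s (map suc cs)

𝒞s-full : ∀ cs α → coeff (𝒞s (map suc cs)) (length cs ∷ α) ≡ coeff (𝒞s cs) α
𝒞s-full []       α = refl
𝒞s-full (c ∷ cs) α = trans
  (𝒯-𝒞 c (length cs) F α)
  (trans
    (0+ _ (𝒞-zero (suc c) (𝒯 (suc (length cs)) F) (𝒞s-high cs (ℕ.n<1+n (length cs))) α))
    (𝒞-cong c {𝒯 (length cs) F} {𝒞s cs} (𝒞s-full cs) α))
  where F = 𝒞s (map suc cs)

-- Empty columns at the end have no effect.
𝒞s-extend : ∀ (f : ℕ → ℕ) {m n} → m ≤ n → (∀ j → m ≤ j → f j ≡ 0) →
            𝒞s (applyUpTo f n) ≈ 𝒞s (applyUpTo f m)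
𝒞s-extend f {zero}  {zero}  _         e α = refl
𝒞s-extend f {zero}  {suc n} _         e α = begin
  coeff (𝒞 (f 0) (𝒞s (applyUpTo (f ∘ suc) n))) α
    ≡⟨ cong (λ c → coeff (𝒞 c (𝒞s (applyUpTo (f ∘ suc) n))) α) (e 0 z≤n) ⟩
  coeff (𝒞 0 (𝒞s (applyUpTo (f ∘ suc) n))) α
    ≡⟨ 𝒞-cong 0 {𝒞s (applyUpTo (f ∘ suc) n)} {1Λ}
         (𝒞s-extend (f ∘ suc) {0} {n} z≤n (λ j _ → e (suc j) z≤n)) α ⟩
  coeff (𝒞 0 1Λ) α
    ≡⟨ 𝒞-1 α ⟩
  coeff 1Λ α ∎
  where open ≡-Reasoning
𝒞s-extend f {suc m} {suc n} (s≤s m≤n) e α =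
  𝒞-cong (f 0) {𝒞s (applyUpTo (f ∘ suc) n)} {𝒞s (applyUpTo (f ∘ suc) m)}
    (𝒞s-extend (f ∘ suc) m≤n (λ j le → e (suc j) (s≤s le))) α

𝒮-high : ∀ l {a} → first l < a → ∀ α → coeff (𝒮 l) (a ∷ α) ≡ 0ℚ
𝒮-high []      lt α = h-high lt α
𝒮-high (x ∷ l) {a} lt α = trans
  (cong (λ cs → coeff (𝒞s cs) (a ∷ α)) (columns-∷ x l))
  (𝒞s-high cs (subst (_< a) (sym (List.length-applyUpTo (height l) x)) lt) α)
  where cs = applyUpTo (height l) x

-- The coefficients at the monomials with the largest possible first exponent are those
-- for the shape without its first row.
𝒮-full : ∀ {x l} → Linked _≥_ l → first l ≤ x → ∀ α → coeff (𝒮 (x ∷ l)) (x ∷ α) ≡ coeff (𝒮 l) α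
𝒮-full {x} {l} dec le α = begin
  coeff (𝒮 (x ∷ l)) (x ∷ α)
    ≡⟨ cong₂ (λ cs n → coeff (𝒞s cs) (n ∷ α)) (columns-∷ x l) (sym (List.length-applyUpTo (height l) x)) ⟩
  coeff (𝒞s (map suc cs)) (length cs ∷ α)
    ≡⟨ 𝒞s-full cs α ⟩
  coeff (𝒞s cs) α
    ≡⟨ 𝒞s-extend (height l) le (height-above dec) α ⟩
  coeff (𝒮 l) α ∎
  where
  open ≡-Reasoning
  cs = applyUpTo (height l) x

first-tail : ∀ {x l} → Linked _≥_ (x ∷ l) → first l ≤ x
first-tail [-]     = z≤n
first-tail (p ∷ _) = p

Linked-∷ : ∀ {x l} → first l ≤ x → Linked _≥_ l → Linked _≥_ (x ∷ l)
Linked-∷ le []       = [-]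
Linked-∷ le [-]      = le ∷ [-]
Linked-∷ le (p ∷ ps) = le ∷ p ∷ ps

𝒮-diagonal : ∀ {l} → Linked _≥_ l → coeff (𝒮 l) l ≡ 1ℚ
𝒮-diagonal {[]}    _   = refl
𝒮-diagonal {x ∷ l} dec = trans
  (𝒮-full (Linked.tail dec) (first-tail dec) l) (𝒮-diagonal (Linked.tail dec))

𝒮-homogeneous : ∀ {l} → Shape l → ∀ α → sum α ≢ sum l → coeff (𝒮 l) α ≡ 0ℚ
𝒮-homogeneous {l} S []      ne = trans (𝒮-[] S) (⟦⟧-no (sum l ℕ.≟ 0) (λ p → ⊥-elim (ne (sym p))))
𝒮-homogeneous {l} S (a ∷ α) ne = trans (𝒮-branching S a α)
  (∑-zero (All.map (λ {m} st → term m (IsStrip.shape st)) (strips-All l)))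
  where
  term : ∀ m → Shape m → weight a l m * coeff (𝒮 m) α ≡ 0ℚ
  term m T with sum m ℕ.+ a ℕ.≟ sum l
  ... | no  _ = ℚ.*-zeroˡ (coeff (𝒮 m) α)
  ... | yes p = *0 1ℚ (𝒮-homogeneous T α (λ q → ne (trans (cong (a ℕ.+_) q)
    (trans (ℕ.+-comm a (sum m)) p))))

-- The order in which the Schur functions are unitriangular: l ▷ l′ holds if the
-- monomial with exponents l does not occur in the Schur function of shape l′.
_▷_ : List ℕ → List ℕ → Set
l ▷ l′ = Linked _≥_ l′ → coeff (𝒮 l′) l ≡ 0ℚ

-- The partitions with at most k parts, all at most m, in decreasing lexicographic order.
partitions : ℕ → ℕ → List (List ℕ)
partitions zero    _       = [] ∷ []
partitions (suc k) zero    = [] ∷ []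
partitions (suc k) (suc m) = map (suc m ∷_) (partitions k (suc m)) ++ partitions (suc k) m

-- l is a partition with all parts at most m.
record IsPartition (m : ℕ) (l : List ℕ) : Set where
  field
    linked : Linked _≥_ l
    pos    : All (0 <_) l
    bound  : first l ≤ m

partitions-All : ∀ k m → All (IsPartition m) (partitions k m)
partitions-All zero    m       = record { linked = [] ; pos = [] ; bound = z≤n } ∷ []
partitions-All (suc k) zero    = record { linked = [] ; pos = [] ; bound = z≤n } ∷ []
partitions-All (suc k) (suc m) = All.++⁺
  (All.map⁺ (All.map (λ v → let open IsPartition v in record
    { linked = Linked-∷ bound linked ; pos = s≤s z≤n ∷ pos ; bound = ℕ.≤-refl })
    (partitions-All k (suc m))))
  (All.map (λ v → let open IsPartition v in record
    { linked = linked ; pos = pos ; bound = ℕ.m≤n⇒m≤1+n bound })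
    (partitions-All (suc k) m))

partitions-▷ : ∀ k m → AllPairs _▷_ (partitions k m)
partitions-▷ zero    m       = [] ∷ []
partitions-▷ (suc k) zero    = [] ∷ []
partitions-▷ (suc k) (suc m) = AllPairs.++⁺
  (AllPairs.map⁺ (AllPairs.map
    (λ {l} {l′} l▷l′ dec → trans
      (𝒮-full (Linked.tail dec) (first-tail dec) l) (l▷l′ (Linked.tail dec)))
    (partitions-▷ k (suc m))))
  (partitions-▷ (suc k) m)
  (All.map⁺ (All.universal
    (λ l → All.map (λ {l′} v _ → 𝒮-high l′ (s≤s (IsPartition.bound v)) l)
      (partitions-All (suc k) m))
    (partitions k (suc m))))

∈-partitions : ∀ k m {l} → IsPartition m l → length l ≤ k → l ∈ partitions k m
∈-partitions zero    m       {[]}    v _ = here refl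
∈-partitions (suc k) zero    {[]}    v _ = here refl
∈-partitions (suc k) (suc m) {[]}    v _ = ∈-++⁺ʳ (map (suc m ∷_) (partitions k (suc m)))
  (∈-partitions (suc k) m (record { linked = [] ; pos = [] ; bound = z≤n }) z≤n)
∈-partitions (suc k) zero    {x ∷ l} v _ with record { linked = _ ; pos = p ∷ _ ; bound = b } ← v =
  contradiction (ℕ.≤-trans p b) (λ ())
∈-partitions (suc k) (suc m) {x ∷ l} v (s≤s le)
  with record { linked = dec ; pos = p ∷ ps ; bound = b } ← v | x ℕ.≟ suc m
... | yes refl = ∈-++⁺ˡ (∈-map⁺ (suc m ∷_) (∈-partitions k (suc m)
  (record { linked = Linked.tail dec ; pos = ps ; bound = first-tail dec }) le))
... | no x≢    = ∈-++⁺ʳ (map (suc m ∷_) (partitions k (suc m))) (∈-partitions (suc k) m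
  (record { linked = dec ; pos = p ∷ ps ; bound = ℕ.s≤s⁻¹ (ℕ.≤∧≢⇒< b x≢) }) (s≤s le))

length≤sum : ∀ {l} → All (0 <_) l → length l ≤ sum l
length≤sum []       = z≤n
length≤sum (p ∷ ps) = ℕ.+-mono-≤ p (length≤sum ps)

first≤sum : ∀ l → first l ≤ sum l
first≤sum []      = z≤n
first≤sum (x ∷ l) = ℕ.m≤m+n x (sum l)

-- All partitions of size at most n occur among those with at most n parts of size at most n.
parts-∈ : ∀ {n} p → sum (parts p) ≤ n → parts p ∈ partitions n n
parts-∈ {n} p le = ∈-partitions n n
  (record { linked = decreasing p ; pos = positive p ; bound = ℕ.≤-trans (first≤sum (parts p)) le })
  (ℕ.≤-trans (length≤sum (positive p)) le)

-- Sorting the nonzero exponents of a monomial.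
normalise : ∀ α → Σ[ p ∈ Partition ] (∀ F → coeff F α ≡ coeff F (parts p)) × sum (parts p) ≡ sum α
normalise α =
  record { parts      = sort β
         ; decreasing = sort-↗ β
         ; positive   = All-resp-↭ (↭-sym (sort-↭ β)) (All.all-filter (0 ℕ.<?_) α)
         } ,
  (λ F → trans (nonzero F α) (symmetric F (↭-sym (sort-↭ β)))) ,
  trans (sum-↭ (sort-↭ β)) (sum-nonzero α)
  where
  β = filter (0 ℕ.<?_) α
  nonzero : ∀ F α → coeff F α ≡ coeff F (filter (0 ℕ.<?_) α)
  nonzero F []          = refl
  nonzero F (zero ∷ α)  = trans (coeff-0∷ F α) (nonzero F α)
  nonzero F (suc a ∷ α) = nonzero (𝒯 (suc a) F) α
  sum-nonzero : ∀ α → sum (filter (0 ℕ.<?_) α) ≡ sum α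
  sum-nonzero []          = refl
  sum-nonzero (zero ∷ α)  = sum-nonzero α
  sum-nonzero (suc a ∷ α) = cong (suc a ℕ.+_) (sum-nonzero α)

-- A linear combination of the Schur functions indexed by a triangular list E that has
-- the same coefficients as F at the monomials in E.  It is found by elimination: the
-- multiple of the first Schur function is read off and subtracted from F.
interpolate : ∀ E → AllPairs _▷_ E → All (Linked _≥_) E → All (All (0 <_)) E → ∀ F →
  Σ[ L ∈ List (ℚ × Partition) ]
    All (λ (_ , μ) → parts μ ∈ E) L
  × (∀ {l} → l ∈ E → coeff F l ≡ ∑ L (λ (q , μ) → q * coeff (schur μ) l))
interpolate []      _              _            _            F = [] , [] , λ ()
interpolate (l ∷ E) (l▷ ∷ E▷) (dec ∷ decs) (pos ∷ poss) F
  with L , L⊆E , eq ← interpolate E E▷ decs poss (F +Λ (- coeff F l) • 𝒮 l) =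
  (q , record { parts = l ; decreasing = dec ; positive = pos }) ∷ L ,
  here refl ∷ All.map there L⊆E ,
  λ { (here refl) → sym (trans (cong₂ _+_
        (trans (cong (q *_) (𝒮-diagonal dec)) (ℚ.*-identityʳ q))
        (∑-zero (All.map (λ { {q′ , μ} μ∈ → *0 q′ (All.lookup l▷ μ∈ (decreasing μ)) }) L⊆E)))
        (ℚ.+-identityʳ q))
    ; (there {xs = _} l′∈) → trans (restore q (coeff F _) (coeff (𝒮 l) _))
        (cong (q * coeff (𝒮 l) _ +_) (eq l′∈)) }
  where
  q = coeff F l
  restore : ∀ q x y → x ≡ q * y + (x + - q * y)
  restore = solve 3 (λ q x y → x := q :* y :+ (x :+ (:- q) :* y)) refl
    where open +-*-Solver

-- By homogeneity, interpolation at the partitions of size at most degree F suffices.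
schur-spanning : ∀ F → ∃[ L ] F ≈ ∑Λ {ℚ × Partition} L (λ (q , μ) → q • schur μ)
schur-spanning F = L , λ α → trans (expand α) (sym (∑Λ-coeff L (λ (q , μ) → q • schur μ) α))
  where
  N = degree F
  small? = λ (l : List ℕ) → sum l ℕ.≤? N
  E = filter small? (partitions N N)
  valid = All.filter⁺ small? (partitions-All N N)
  I = interpolate E (AllPairs.filter⁺ small? (partitions-▷ N N))
        (All.map IsPartition.linked valid) (All.map IsPartition.pos valid) F
  L = proj₁ I
  expand : ∀ α → coeff F α ≡ ∑ L (λ (q , μ) → q * coeff (schur μ) α)
  expand α with normalise α
  ... | p , norm , sum-p with ℕ.≤-<-connex (sum α) N
  ... | inj₁ α≤N = begin
    coeff F α          ≡⟨ norm F ⟩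
    coeff F (parts p)  ≡⟨ proj₂ (proj₂ I) (∈-filter⁺ small? (parts-∈ p le) le) ⟩
    ∑ L (λ (q , μ) → q * coeff (schur μ) (parts p))
      ≡⟨ ∑-cong L (λ (q , μ) → cong (q *_) (norm (schur μ))) ⟨
    ∑ L (λ (q , μ) → q * coeff (schur μ) α) ∎
    where
    open ≡-Reasoning
    le = subst (_≤ N) (sym sum-p) α≤N
  ... | inj₂ N<α = trans (bounded F α N<α) (sym (∑-zero (All.map
    (λ { {q , μ} μ∈ → *0 q (𝒮-homogeneous (Linked⇒Shape (decreasing μ)) α
      (λ eq → ℕ.<⇒≱ N<α (subst (_≤ N) (sym eq)
        (proj₂ (∈-filter⁻ small? {xs = partitions N N} μ∈))))) })
    (proj₁ (proj₂ I)))))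

-- The proofs that a list is a partition are irrelevant.
parts-injective : ∀ p q → parts p ≡ parts q → p ≡ q
parts-injective record { parts = l ; decreasing = d₁ ; positive = p₁ }
                record { parts = l ; decreasing = d₂ ; positive = p₂ } refl
  rewrite Linked.irrelevant ℕ.≤-irrelevant d₁ d₂ | All.irrelevant ℕ.≤-irrelevant p₁ p₂ = refl

-- The coefficients of a vanishing combination vanish in the order of E.  The last
-- hypothesis says that those not indexed by E are known to vanish.
triangular-independent : ∀ E → AllPairs _▷_ E → (L : List Partition) (a : Partition → ℚ) → Unique L →
  (∀ l → ∑ L (λ μ → a μ * coeff (schur μ) l) ≡ 0ℚ) →
  (∀ {μ} → μ ∈ L → parts μ ∈ E ⊎ a μ ≡ 0ℚ) → ∀ {μ} → μ ∈ L → a μ ≡ 0ℚ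
triangular-independent [] _ L a u zero-sum cover μ∈ with cover μ∈
... | inj₂ a≡0 = a≡0
triangular-independent (l ∷ E) (l▷ ∷ E▷) L a u zero-sum cover =
  triangular-independent E E▷ L a u zero-sum shrink
  where
  leading : ∀ {μ} → μ ∈ L → parts μ ≡ l → a μ ≡ 0ℚ
  leading {μ} μ∈ refl = begin
    a μ                          ≡⟨ ℚ.*-identityʳ (a μ) ⟨
    a μ * 1ℚ                     ≡⟨ cong (a μ *_) (𝒮-diagonal (decreasing μ)) ⟨
    a μ * coeff (schur μ) l      ≡⟨ ∑-unique (λ μ → a μ * coeff (schur μ) l) u μ∈ off ⟨
    ∑ L (λ μ → a μ * coeff (schur μ) l) ≡⟨ zero-sum l ⟩
    0ℚ                           ∎
    where
    open ≡-Reasoning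
    off : ∀ {ν} → ν ∈ L → ν ≢ μ → a ν * coeff (schur ν) l ≡ 0ℚ
    off {ν} ν∈ ν≢μ with cover ν∈
    ... | inj₁ (here eq)  = ⊥-elim (ν≢μ (parts-injective ν μ eq))
    ... | inj₁ (there ∈E) = *0 (a ν) (All.lookup l▷ ∈E (decreasing ν))
    ... | inj₂ a≡0        = 0* (coeff (schur ν) l) a≡0
  shrink : ∀ {μ} → μ ∈ L → parts μ ∈ E ⊎ a μ ≡ 0ℚ
  shrink μ∈ with cover μ∈
  ... | inj₁ (here eq)  = inj₂ (leading μ∈ eq)
  ... | inj₁ (there ∈E) = inj₁ ∈E
  ... | inj₂ a≡0        = inj₂ a≡0

schur-independent : ∀ (L : List Partition) (a : Partition → ℚ) → Unique L →
                    ∑Λ L (λ μ → a μ • schur μ) ≈ 0Λ → ∀ {μ} → μ ∈ L → a μ ≡ 0ℚ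
schur-independent L a u zero-sum = triangular-independent
  (partitions N N) (partitions-▷ N N) L a u
  (λ l → trans (sym (∑Λ-coeff L (λ μ → a μ • schur μ) l)) (zero-sum l))
  (λ {μ} μ∈ → inj₁ (parts-∈ μ (size≤ L μ∈)))
  where
  size : List Partition → ℕ
  size L = sum (map (sum ∘ parts) L)
  N = size L
  size≤ : ∀ L {μ} → μ ∈ L → sum (parts μ) ≤ size L
  size≤ (μ ∷ L) (here refl) = ℕ.m≤m+n (sum (parts μ)) (size L)
  size≤ (μ ∷ L) (there μ∈)  = ℕ.≤-trans (size≤ L μ∈) (ℕ.m≤n+m (size L) (sum (parts μ)))

-- Generation by the complete symmetric functions

-- The subalgebra generated by the complete symmetric functions.  Elements of Λ matter
-- only up to _≈_, so it is closed under _≈_ as well.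
data Polynomial : Λ → Set where
  gen   : ∀ n → Polynomial (h n)
  add   : ∀ {F G} → Polynomial F → Polynomial G → Polynomial (F +Λ G)
  scale : ∀ q {F} → Polynomial F → Polynomial (q • F)
  mul   : ∀ {F G} → Polynomial F → Polynomial G → Polynomial (F *Λ G)
  resp  : ∀ {F G} → F ≈ G → Polynomial F → Polynomial G

poly-≈0 : ∀ {F} → F ≈ 0Λ → Polynomial F
poly-≈0 {F} p = resp {0ℚ • h 0} (λ α → trans (ℚ.*-zeroˡ (coeff (h 0) α)) (sym (p α))) (scale 0ℚ (gen 0))

poly-∑ : ∀ {A : Set} {xs} (t : A → Λ) → All (Polynomial ∘ t) xs → Polynomial (∑Λ xs t)
poly-∑ t []       = poly-≈0 {0Λ} (λ _ → refl)
poly-∑ t (p ∷ ps) = add p (poly-∑ t ps)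

-- Any F with the coefficients of a convolution of elements of the subalgebra is in it.
poly-⨁ : ∀ n (T : ℕ → ℕ → Λ) → (∀ i j → Polynomial (T i j)) → ∀ {F} →
         (∀ α → coeff F α ≡ ⨁ n (λ i j → coeff (T i j) α)) → Polynomial F
poly-⨁ n T p {F} eq = let H , ps , eq′ = go n T p in resp {H} {F} (λ α → trans (eq′ α) (sym (eq α))) ps
  where
  go : ∀ n (T : ℕ → ℕ → Λ) → (∀ i j → Polynomial (T i j)) →
       Σ[ H ∈ Λ ] Polynomial H × (∀ α → coeff H α ≡ ⨁ n (λ i j → coeff (T i j) α))
  go zero    T p = T 0 0 , p 0 0 , λ _ → refl
  go (suc n) T p = let H , ps , eq = go n (T ∘ suc) (p ∘ suc) in
    T 0 (suc n) +Λ H , add (p 0 (suc n)) ps , λ α → cong (coeff (T 0 (suc n)) α +_) (eq α)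

poly-𝒯 : ∀ {F} → Polynomial F → ∀ a → Polynomial (𝒯 a F)
poly-𝒯 (gen n) a with ℕ.≤-<-connex a n
... | inj₂ n<a = poly-≈0 {𝒯 a (h n)} (h-high n<a)
... | inj₁ a≤n with k , refl ← ℕ.m≤n⇒∃[o]m+o≡n a≤n =
  resp {h k} {𝒯 a (h (a ℕ.+ k))} (λ α → sym (h-+∷ k a α)) (gen k)
poly-𝒯 (add {F} {G} p p′) a = resp {𝒯 a F +Λ 𝒯 a G} (λ _ → refl) (add (poly-𝒯 p a) (poly-𝒯 p′ a))
poly-𝒯 (scale q {F} p)    a = resp {q • 𝒯 a F} (λ _ → refl) (scale q (poly-𝒯 p a))
poly-𝒯 (mul {F} {G} p p′) a = poly-⨁ a (λ i j → 𝒯 i F *Λ 𝒯 j G)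
  (λ i j → mul (poly-𝒯 p i) (poly-𝒯 p′ j)) {𝒯 a (F *Λ G)} (λ _ → refl)
poly-𝒯 (resp {F} {G} e p) a = resp {𝒯 a F} {𝒯 a G} (e ∘ (a ∷_)) (poly-𝒯 p a)

-- As 𝒞 1 hₙ is the alternating sum of the eₖ₊₁ hₙ₋ₖ, this is the familiar relation
-- between the elementary and the complete symmetric functions.
𝒞-h : ∀ n → 𝒞 1 (h n) ≈ h (suc n)
𝒞-h n = go (suc n) n (ℕ.n<1+n n)
  where
  open ≡-Reasoning
  go : ∀ N n → n < N → 𝒞 1 (h n) ≈ h (suc n)
  go (suc N) n lt [] = 𝒞-[] 0 (h n)
  go (suc N) n lt (zero ∷ α) = trans (coeff-0∷ (𝒞 1 (h n)) α) (go (suc N) n lt α)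
  go (suc N) n lt (suc a ∷ α) = trans (𝒯-𝒞 0 a (h n) α) (step (ℕ.<-cmp a n))
    where
    step : _ → coeff (𝒞 1 (𝒯 (suc a) (h n))) α + coeff (𝒞 0 (𝒯 a (h n))) α ≡
               coeff (h (suc n)) (suc a ∷ α)
    step (tri> _ _ n<a) = trans
      (0+0 (𝒞-zero 1 (𝒯 (suc a) (h n)) (h-high (ℕ.m≤n⇒m≤1+n n<a)) α)
           (𝒞-zero 0 (𝒯 a (h n)) (h-high n<a) α))
      (sym (h-high (s≤s n<a) α))
    step (tri≈ _ refl _) = begin
      coeff (𝒞 1 (𝒯 (suc a) (h a))) α + coeff (𝒞 0 (𝒯 a (h a))) α
        ≡⟨ 0+ _ (𝒞-zero 1 (𝒯 (suc a) (h a)) (h-high (ℕ.n<1+n a)) α) ⟩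
      coeff (𝒞 0 (𝒯 a (h a))) α
        ≡⟨ 𝒞-cong 0 {𝒯 a (h a)} {1Λ} (top a) α ⟩
      coeff (𝒞 0 1Λ) α
        ≡⟨ 𝒞-1 α ⟩
      coeff 1Λ α
        ≡⟨ top (suc a) α ⟨
      coeff (h (suc a)) (suc a ∷ α) ∎
      where
      top : ∀ n α → coeff (h n) (n ∷ α) ≡ coeff 1Λ α
      top n α = trans (cong (λ k → coeff (h k) (n ∷ α)) (sym (ℕ.+-identityʳ n))) (h-+∷ 0 n α)
    step (tri< a<n _ _) with k , refl ← ℕ.m≤n⇒∃[o]m+o≡n a<n = begin
      coeff (𝒞 1 (𝒯 (suc a) (h n))) α + coeff (𝒞 0 (𝒯 a (h n))) α
        ≡⟨ cong₂ _+_ (𝒞-cong 1 {𝒯 (suc a) (h n)} {h k} (h-+∷ k (suc a)) α)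
             (𝒞-cong 0 {𝒯 a (h n)} {𝒞 1 (h k)} (λ β → trans (lower a β) (sym (rec β))) α) ⟩
      coeff (𝒞 1 (h k)) α + coeff (𝒞 0 (𝒞 1 (h k))) α
        ≡⟨ +0 _ (𝒞-𝒞 0 (h k) α) ⟩
      coeff (𝒞 1 (h k)) α
        ≡⟨ rec α ⟩
      coeff (h (suc k)) α
        ≡⟨ lower (suc a) α ⟨
      coeff (h (suc n)) (suc a ∷ α) ∎
      where
      rec : 𝒞 1 (h k) ≈ h (suc k)
      rec = go N k (ℕ.≤-trans (s≤s (ℕ.m≤n+m k a)) (ℕ.s≤s⁻¹ lt))
      lower : ∀ b α → coeff (h (suc b ℕ.+ k)) (b ∷ α) ≡ coeff (h (suc k)) α
      lower b α = trans (cong (λ i → coeff (h i) (b ∷ α)) (sym (ℕ.+-suc b k))) (h-+∷ (suc k) b α)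

sign-involutive : ∀ n q → sign n * (sign n * q) ≡ q
sign-involutive zero    q = trans (ℚ.*-identityˡ (1ℚ * q)) (ℚ.*-identityˡ q)
sign-involutive (suc n) q = trans (square (sign n) q) (sign-involutive n q)
  where
  square : ∀ a q → - a * (- a * q) ≡ a * (a * q)
  square = solve 2 (λ a q → (:- a) :* ((:- a) :* q) := a :* (a :* q)) refl
    where open +-*-Solver

-- The relation 𝒞-h solved for its last term eₙ₊₁.
e-recursion : ∀ n → sign n • (h (suc n) +Λ (- 1ℚ) • ∑Λ (upTo n) (λ k → sign k • (e (suc k) *Λ 𝒯 k (h n))))
                    ≈ e (suc n)
e-recursion n α = begin
  sign n * (coeff (h (suc n)) α + - 1ℚ * coeff (∑Λ (upTo n) tail) α)
    ≡⟨ cong₂ (λ x y → sign n * (x + - 1ℚ * y))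
         (trans (sym (𝒞-h n α)) (trans (𝒞-column 1 (h n) (ℕ.n<1+n n) α) (Σ<-last n term)))
         (trans (∑Λ-coeff (upTo n) tail α) (∑-upTo n term)) ⟩
  sign n * ((term n + Σ< n term) + - 1ℚ * Σ< n term)
    ≡⟨ cong (sign n *_) (cancel (term n) (Σ< n term)) ⟩
  sign n * term n
    ≡⟨ sign-involutive n _ ⟩
  (coeff (e (suc n)) ⊛ (coeff (h n) ∘ (n ∷_))) α
    ≡⟨ ⊛-cong {F = coeff (e (suc n))} (λ _ → refl) top α ⟩
  (coeff (e (suc n)) ⊛ coeff 1Λ) α
    ≡⟨ ⊛-comm (coeff (e (suc n))) (coeff 1Λ) α ⟩
  (coeff 1Λ ⊛ coeff (e (suc n))) α
    ≡⟨ ⊛-identityˡ (e (suc n)) α ⟩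
  coeff (e (suc n)) α ∎
  where
  open ≡-Reasoning
  tail : ℕ → Λ
  tail k = sign k • (e (suc k) *Λ 𝒯 k (h n))
  term : ℕ → ℚ
  term k = sign k * (coeff (e (suc k)) ⊛ (coeff (h n) ∘ (k ∷_))) α
  top : ∀ γ → coeff (h n) (n ∷ γ) ≡ coeff 1Λ γ
  top γ = trans (cong (λ k → coeff (h k) (n ∷ γ)) (sym (ℕ.+-identityʳ n))) (h-+∷ 0 n γ)
  cancel : ∀ x y → (x + y) + - 1ℚ * y ≡ x
  cancel = solve 2 (λ x y → (x :+ y) :+ (:- con 1ℚ) :* y := x) refl
    where open +-*-Solver

poly-e : ∀ n → Polynomial (e n)
poly-e n = go (suc n) n (ℕ.n<1+n n)
  where
  go : ∀ N n → n < N → Polynomial (e n)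
  go (suc N) zero    lt       = resp {1Λ} {e 0} (λ α → sym (e0≈1 α)) (gen 0)
  go (suc N) (suc n) (s≤s lt) = resp {G = e (suc n)} (e-recursion n) (scale (sign n) (add (gen (suc n))
    (scale (- 1ℚ) (poly-∑ (λ k → sign k • (e (suc k) *Λ 𝒯 k (h n))) (All.applyUpTo⁺₁ id n (λ {k} k<n →
      scale (sign k) (mul (go N (suc k) (ℕ.≤-<-trans k<n lt)) (poly-𝒯 (gen n) k))))))))

poly-𝒞 : ∀ m {F} → Polynomial F → Polynomial (𝒞 m F)
poly-𝒞 m {F} p = poly-∑ (λ k → sign k • (e (m ℕ.+ k) *Λ 𝒯 k F)) (All.universal
  (λ k → scale (sign k) (mul (poly-e (m ℕ.+ k)) (poly-𝒯 p k))) (upTo (suc (degree F))))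

poly-𝒞s : ∀ cs → Polynomial (𝒞s cs)
poly-𝒞s []       = gen 0
poly-𝒞s (c ∷ cs) = poly-𝒞 c (poly-𝒞s cs)

-- Λ is generated by the complete symmetric functions.
polynomial : ∀ F → Polynomial F
polynomial F = let L , F≈ = schur-spanning F in
  resp {G = F} (λ α → sym (F≈ α)) (poly-∑ (λ (q , μ) → q • schur μ)
    (All.universal (λ (q , μ) → scale q (poly-𝒞s (columns (parts μ)))) L))

-- Composition of power series

^-cong : ∀ {p q} → p ≗ q → ∀ k → p ^ k ≗ q ^ k
^-cong e zero    n = refl
^-cong e (suc k) n = ·-cong e (^-cong e k) n

·-comm : ∀ p q → p · q ≗ q · p
·-comm p q n = trans (⨁-sym n (λ i j → p i * q j)) (⨁-cong n (λ i j → ℚ.*-comm (p j) (q i)))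

·-identityˡ : ∀ p → 1ᵖ · p ≗ p
·-identityˡ p n = trans
  (⨁-first n (λ i j → 1ᵖ i * p j) (λ i j → ℚ.*-zeroˡ (p j))) (ℚ.*-identityˡ (p n))

·-assoc : ∀ p q u → (p · q) · u ≗ p · (q · u)
·-assoc p q u n = begin
  ((p · q) · u) n ≡⟨ ·-comm (p · q) u n ⟩
  (u · (p · q)) n ≡⟨ ·-leftComm u p q n ⟩
  (p · (u · q)) n ≡⟨ ·-cong {p = p} (λ _ → refl) (·-comm u q) n ⟩
  (p · (q · u)) n ∎
  where open ≡-Reasoning

^-+ : ∀ p a b → p ^ (a ℕ.+ b) ≗ p ^ a · p ^ b
^-+ p zero    b n = sym (·-identityˡ (p ^ b) n)
^-+ p (suc a) b n = trans
  (·-cong {p = p} (λ _ → refl) (^-+ p a b) n) (sym (·-assoc p (p ^ a) (p ^ b) n))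

z-^ : ∀ a n → (z ^ a) n ≡ ⟦ a ℕ.≟ n ⟧
z-^ zero    zero    = refl
z-^ zero    (suc n) = refl
z-^ (suc a) zero    = ℚ.*-zeroˡ ((z ^ a) 0)
z-^ (suc a) (suc n) = begin
  0ℚ * (z ^ a) (suc n) + ⨁ n (λ i j → z (suc i) * (z ^ a) j)
    ≡⟨ 0+ _ (ℚ.*-zeroˡ ((z ^ a) (suc n))) ⟩
  ⨁ n (λ i j → z (suc i) * (z ^ a) j)
    ≡⟨ ⨁-first n _ (λ i j → ℚ.*-zeroˡ ((z ^ a) j)) ⟩
  1ℚ * (z ^ a) n
    ≡⟨ ℚ.*-identityˡ ((z ^ a) n) ⟩
  (z ^ a) n
    ≡⟨ z-^ a n ⟩
  ⟦ a ℕ.≟ n ⟧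
    ≡⟨ ⟦⟧-cong (a ℕ.≟ n) (suc a ℕ.≟ suc n) (cong suc) ℕ.suc-injective ⟩
  ⟦ suc a ℕ.≟ suc n ⟧ ∎
  where open ≡-Reasoning

-- The coefficient of z^n in p(f(z)), where f has no constant term.
compose : Power → Power → Power
compose p f n = Σ< (suc n) (λ k → p k * (f ^ k) n)

module _ (f : Power) (f0 : f 0 ≡ 0ℚ) where

  compose-extend : ∀ p {n K} → n < K → Σ< K (λ k → p k * (f ^ k) n) ≡ compose p f n
  compose-extend p {n} lt =
    Σ<-extend lt (λ k → p k * (f ^ k) n) (λ k n<k → *0 (p k) (^-order f f0 k n n<k))

  -- Substitution is multiplicative.  All sums are extended to a common range K, where
  -- the terms with k + l ≥ K vanish as f^(k+l) has order at least k + l.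
  compose-· : ∀ p q → compose (p · q) f ≗ compose p f · compose q f
  compose-· p q n = sym (trans
    (⨁-cong-≡ n (λ { i j refl → cong₂ _*_
      (sym (compose-extend p (s≤s (ℕ.m≤m+n i j))))
      (sym (compose-extend q (s≤s (ℕ.m≤n+m j i)))) }))
    (go (suc n) ℕ.≤-refl))
    where
    open ≡-Reasoning
    go : ∀ K → n < K →
      ⨁ n (λ i j → Σ< K (λ k → p k * (f ^ k) i) * Σ< K (λ l → q l * (f ^ l) j)) ≡
      compose (p · q) f n
    go K lt = begin
      ⨁ n (λ i j → Σ< K (λ k → p k * (f ^ k) i) * Σ< K (λ l → q l * (f ^ l) j))
        ≡⟨ ⨁-cong n (λ i j → product i j) ⟩
      ⨁ n (λ i j → Σ< K (λ k → Σ< K (λ l → (p k * q l) * ((f ^ k) i * (f ^ l) j))))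
        ≡⟨ Σ<-⨁ K n (λ k i j → Σ< K (λ l → (p k * q l) * ((f ^ k) i * (f ^ l) j))) ⟩
      Σ< K (λ k → ⨁ n (λ i j → Σ< K (λ l → (p k * q l) * ((f ^ k) i * (f ^ l) j))))
        ≡⟨ Σ<-cong K (λ k → Σ<-⨁ K n (λ l i j → (p k * q l) * ((f ^ k) i * (f ^ l) j))) ⟩
      Σ< K (λ k → Σ< K (λ l → ⨁ n (λ i j → (p k * q l) * ((f ^ k) i * (f ^ l) j))))
        ≡⟨ Σ<-cong K (λ k → Σ<-cong K (λ l → trans
             (sym (⨁-* n (p k * q l) (λ i j → (f ^ k) i * (f ^ l) j)))
             (cong (p k * q l *_) (sym (^-+ f k l n))))) ⟩
      Σ< K (λ k → Σ< K (λ l → (p k * q l) * (f ^ (k ℕ.+ l)) n))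
        ≡⟨ ⨁-square K ℕ.≤-refl (λ k l → (p k * q l) * (f ^ (k ℕ.+ l)) n)
             (λ k l le → *0 (p k * q l) (^-order f f0 (k ℕ.+ l) n (ℕ.<-≤-trans lt le))) ⟨
      Σ< K (λ m → ⨁ m (λ k l → (p k * q l) * (f ^ (k ℕ.+ l)) n))
        ≡⟨ Σ<-cong K (λ m → trans
             (⨁-cong-≡ m (λ { k l refl → ℚ.*-comm (p k * q l) ((f ^ m) n) }))
             (trans (sym (⨁-* m ((f ^ m) n) (λ k l → p k * q l)))
               (ℚ.*-comm ((f ^ m) n) ((p · q) m)))) ⟩
      Σ< K (λ m → (p · q) m * (f ^ m) n)
        ≡⟨ compose-extend (p · q) lt ⟩
      compose (p · q) f n ∎
      where
      product : ∀ i j → Σ< K (λ k → p k * (f ^ k) i) * Σ< K (λ l → q l * (f ^ l) j) ≡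
                Σ< K (λ k → Σ< K (λ l → (p k * q l) * ((f ^ k) i * (f ^ l) j)))
      product i j = begin
        Σ< K (λ k → p k * (f ^ k) i) * Q
          ≡⟨ ℚ.*-comm _ Q ⟩
        Q * Σ< K (λ k → p k * (f ^ k) i)
          ≡⟨ Σ<-* K Q (λ k → p k * (f ^ k) i) ⟩
        Σ< K (λ k → Q * (p k * (f ^ k) i))
          ≡⟨ Σ<-cong K (λ k → trans (ℚ.*-comm Q _)
               (trans (Σ<-* K (p k * (f ^ k) i) (λ l → q l * (f ^ l) j))
                 (Σ<-cong K (λ l → *-interchange (p k) ((f ^ k) i) (q l) ((f ^ l) j))))) ⟩
        Σ< K (λ k → Σ< K (λ l → (p k * q l) * ((f ^ k) i * (f ^ l) j))) ∎
        where Q = Σ< K (λ l → q l * (f ^ l) j)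

  -- Hence it commutes with powers.
  compose-^ : ∀ p a → compose (p ^ a) f ≗ compose p f ^ a
  compose-^ p zero    n = trans
    (+0 (1ℚ * 1ᵖ n) (Σ<-zero n (λ k → ℚ.*-zeroˡ ((f ^ suc k) n)))) (ℚ.*-identityˡ (1ᵖ n))
  compose-^ p (suc a) n = trans
    (compose-· p (p ^ a) n) (·-cong {p = compose p f} (λ _ → refl) (compose-^ p a) n)

-- If g(f(z)) = z, then g(z)^a becomes z^a on substituting f(z) for z.
compose-inverse : ∀ f g → g ⟪ f ⟫ ≗ z → ∀ a → compose (series g ^ a) (series f) ≗ z ^ a
compose-inverse f g inv a n = trans (compose-^ (series f) (constant f) (series g) a n)
  (^-cong (λ m → trans (sym (∑-upTo (suc m) (λ k → series g k * (series f ^ k) m))) (inv m)) a n)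

-- Umbral operators

-- The coefficient of a monomial in ∏ₓ 1/(1 - f(z)x) is f(z)^a, where a is its degree.
generating-^ : ∀ f α → generating f α ≗ f ^ sum α
generating-^ f []      n = refl
generating-^ f (a ∷ α) n = trans
  (·-cong {p = f ^ a} (λ _ → refl) (generating-^ f α) n) (sym (^-+ f a (sum α) n))

-- rₙ is the combination of the hₖ whose coefficients are those of zⁿ in f(z)^k.
r-h : ∀ f n → r f n ≈ ∑Λ (upTo (suc n)) (λ k → (series f ^ k) n • h k)
r-h f n α = sym (begin
  coeff (∑Λ (upTo (suc n)) (λ k → p k n • h k)) α
    ≡⟨ ∑Λ-coeff (upTo (suc n)) (λ k → p k n • h k) α ⟩
  ∑ (upTo (suc n)) t
    ≡⟨ pick ⟩
  p (sum α) n
    ≡⟨ generating-^ (series f) α n ⟨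
  generating (series f) α n ∎)
  where
  open ≡-Reasoning
  p : ℕ → Power
  p k = series f ^ k
  t : ℕ → ℚ
  t k = p k n * coeff (h k) α
  pick : ∑ (upTo (suc n)) t ≡ p (sum α) n
  pick with ℕ.≤-<-connex (sum α) n
  ... | inj₁ le = begin
    ∑ (upTo (suc n)) t
      ≡⟨ ∑-unique t (Unique.upTo⁺ (suc n)) (∈-upTo⁺ (s≤s le))
           (λ {k} _ k≢ → *0 (p k n) (⟦⟧-no (sum α ℕ.≟ k) (λ eq → ⊥-elim (k≢ (sym eq))))) ⟩
    p (sum α) n * ⟦ sum α ℕ.≟ sum α ⟧
      ≡⟨ cong (p (sum α) n *_) (⟦⟧-yes (sum α ℕ.≟ sum α) refl) ⟩
    p (sum α) n * 1ℚ
      ≡⟨ ℚ.*-identityʳ (p (sum α) n) ⟩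
    p (sum α) n ∎
  ... | inj₂ lt = trans (∑-zero′ (upTo (suc n)) absent)
    (sym (^-order (series f) (constant f) (sum α) n lt))
    where
    absent : ∀ k → t k ≡ 0ℚ
    absent k with sum α ℕ.≟ k
    ... | yes refl = 0* 1ℚ (^-order (series f) (constant f) (sum α) n lt)
    ... | no  _    = ℚ.*-zeroʳ (p k n)

module AlgebraHomomorphism {U : Λ → Λ} (hom : IsAlgebraHomomorphism U) where

  open IsAlgebraHomomorphism hom public
  open IsRingHomomorphism isRingHomomorphism public using ()
    renaming (⟦⟧-cong to U-cong; +-homo to U-+; *-homo to U-*; 0#-homo to U-0; 1#-homo to U-1)

  U-∑ : ∀ {A : Set} xs (q : A → ℚ) (F : A → Λ) α →
        coeff (U (∑Λ xs (λ x → q x • F x))) α ≡ ∑ xs (λ x → q x * coeff (U (F x)) α)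
  U-∑ []       q F α = U-0 α
  U-∑ (x ∷ xs) q F α = trans
    (U-+ (q x • F x) (∑Λ xs (λ x → q x • F x)) α)
    (cong₂ _+_ (•-homo (q x) (F x) α) (U-∑ xs q F α))

module _ {f g : DeltaSeries} {U_f U_g : Λ → Λ}
         (umbral-f : IsUmbralOperator f U_f) (umbral-g : IsUmbralOperator g U_g) where

  private
    module f = IsUmbralOperator umbral-f
    module g = IsUmbralOperator umbral-g
    module Uf = AlgebraHomomorphism f.isAlgebraHomomorphism
    module Ug = AlgebraHomomorphism g.isAlgebraHomomorphism

  -- U_g ∘ U_f maps hₙ to the coefficient of zⁿ in the sum of the g(f(z))^k hₖ, which is hₙ.
  umbral-inverse : g ⟪ f ⟫ ≗ z → ∀ F → U_g (U_f F) ≈ F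
  umbral-inverse inv F = go (polynomial F)
    where
    open ≡-Reasoning
    go : ∀ {F} → Polynomial F → U_g (U_f F) ≈ F
    go (gen n) α = begin
      coeff (U_g (U_f (h n))) α
        ≡⟨ Ug.U-cong {U_f (h n)} {H} (λ β → trans (f.U-h n β) (r-h f n β)) α ⟩
      coeff (U_g H) α
        ≡⟨ Ug.U-∑ (upTo (suc n)) (λ k → (series f ^ k) n) h α ⟩
      ∑ (upTo (suc n)) (λ k → (series f ^ k) n * coeff (U_g (h k)) α)
        ≡⟨ ∑-cong (upTo (suc n)) (λ k → trans
             (cong ((series f ^ k) n *_) (trans (g.U-h k α) (generating-^ (series g) α k)))
             (ℚ.*-comm ((series f ^ k) n) ((series g ^ sum α) k))) ⟩
      ∑ (upTo (suc n)) (λ k → (series g ^ sum α) k * (series f ^ k) n)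
        ≡⟨ ∑-upTo (suc n) (λ k → (series g ^ sum α) k * (series f ^ k) n) ⟩
      compose (series g ^ sum α) (series f) n
        ≡⟨ compose-inverse f g inv (sum α) n ⟩
      (z ^ sum α) n
        ≡⟨ z-^ (sum α) n ⟩
      coeff (h n) α ∎
      where H = ∑Λ (upTo (suc n)) (λ k → (series f ^ k) n • h k)
    go (add {F} {G} p p′) α = begin
      coeff (U_g (U_f (F +Λ G))) α
        ≡⟨ Ug.U-cong {U_f (F +Λ G)} {U_f F +Λ U_f G} (Uf.U-+ F G) α ⟩
      coeff (U_g (U_f F +Λ U_f G)) α
        ≡⟨ Ug.U-+ (U_f F) (U_f G) α ⟩
      coeff (U_g (U_f F)) α + coeff (U_g (U_f G)) α
        ≡⟨ cong₂ _+_ (go p α) (go p′ α) ⟩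
      coeff F α + coeff G α ∎
    go (scale q {F} p) α = begin
      coeff (U_g (U_f (q • F))) α
        ≡⟨ Ug.U-cong {U_f (q • F)} {q • U_f F} (Uf.•-homo q F) α ⟩
      coeff (U_g (q • U_f F)) α
        ≡⟨ Ug.•-homo q (U_f F) α ⟩
      q * coeff (U_g (U_f F)) α
        ≡⟨ cong (q *_) (go p α) ⟩
      q * coeff F α ∎
    go (mul {F} {G} p p′) α = begin
      coeff (U_g (U_f (F *Λ G))) α
        ≡⟨ Ug.U-cong {U_f (F *Λ G)} {U_f F *Λ U_f G} (Uf.U-* F G) α ⟩
      coeff (U_g (U_f F *Λ U_f G)) α
        ≡⟨ Ug.U-* (U_f F) (U_f G) α ⟩
      (coeff (U_g (U_f F)) ⊛ coeff (U_g (U_f G))) α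
        ≡⟨ ⊛-cong (go p) (go p′) α ⟩
      (coeff F ⊛ coeff G) α ∎
    go (resp {F} {G} F≈G p) α = begin
      coeff (U_g (U_f G)) α
        ≡⟨ Ug.U-cong {U_f G} {U_f F} (Uf.U-cong {G} {F} (λ β → sym (F≈G β))) α ⟩
      coeff (U_g (U_f F)) α
        ≡⟨ go p α ⟩
      coeff F α
        ≡⟨ F≈G α ⟩
      coeff G α ∎

-- Coproducts

-- A splitting of F: a finite list of pairs (A , B) such that F(X + X′) is the sum of
-- the A(X) B(X′) and (U F)(X + X′) is the sum of the (U A)(X) (U B)(X′).
record Splitting (U : Λ → Λ) (F : Λ) : Set where
  field
    terms   : List (Λ × Λ)
    split   : ∀ α β → coeff F (α ++ β) ≡ ∑ terms (λ (A , B) → coeff A α * coeff B β)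
    split-U : ∀ α β → coeff (U F) (α ++ β) ≡ ∑ terms (λ (A , B) → coeff (U A) α * coeff (U B) β)

-- The pairs of numbers with sum n.
antidiagonal : ℕ → List (ℕ × ℕ)
antidiagonal zero    = (0 , 0) ∷ []
antidiagonal (suc n) = (0 , suc n) ∷ map (λ (i , j) → suc i , j) (antidiagonal n)

∑-antidiagonal : ∀ n (t : ℕ → ℕ → ℚ) → ∑ (antidiagonal n) (uncurry t) ≡ ⨁ n t
∑-antidiagonal zero    t = ℚ.+-identityʳ (t 0 0)
∑-antidiagonal (suc n) t = cong (t 0 (suc n) +_) (trans
  (∑-map _ (antidiagonal n) (uncurry t)) (∑-antidiagonal n (t ∘ suc)))

module _ {f : DeltaSeries} {U : Λ → Λ} (umbral : IsUmbralOperator f U) where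

  open IsUmbralOperator umbral
  open AlgebraHomomorphism isAlgebraHomomorphism

  -- Splittings are compatible with the operations of the algebra, so it suffices to treat
  -- hₙ.  There both equations come from p^(a+b) = p^a p^b, for p = z and p = f(z).
  splitting : ∀ {F} → Polynomial F → Splitting U F
  splitting (gen n) = record
    { terms   = map hh (antidiagonal n)
    ; split   = λ α β → begin
        coeff (h n) (α ++ β)
          ≡⟨ trans (sym (z-^ (sum (α ++ β)) n)) (power z α β) ⟩
        ⨁ n (λ i j → (z ^ sum α) i * (z ^ sum β) j)
          ≡⟨ ⨁-cong n (λ i j → cong₂ _*_ (z-^ (sum α) i) (z-^ (sum β) j)) ⟩
        ⨁ n (λ i j → coeff (h i) α * coeff (h j) β)
          ≡⟨ list (λ A B → coeff A α * coeff B β) ⟨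
        ∑ (map hh (antidiagonal n)) (λ (A , B) → coeff A α * coeff B β) ∎
    ; split-U = λ α β → begin
        coeff (U (h n)) (α ++ β)
          ≡⟨ trans (U-h n (α ++ β)) (trans (generating-^ (series f) (α ++ β) n) (power (series f) α β)) ⟩
        ⨁ n (λ i j → (series f ^ sum α) i * (series f ^ sum β) j)
          ≡⟨ ⨁-cong n (λ i j → cong₂ _*_
               (trans (U-h i α) (generating-^ (series f) α i))
               (trans (U-h j β) (generating-^ (series f) β j))) ⟨
        ⨁ n (λ i j → coeff (U (h i)) α * coeff (U (h j)) β)
          ≡⟨ list (λ A B → coeff (U A) α * coeff (U B) β) ⟨
        ∑ (map hh (antidiagonal n)) (λ (A , B) → coeff (U A) α * coeff (U B) β) ∎
    }
    where
    open ≡-Reasoning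
    hh : ℕ × ℕ → Λ × Λ
    hh (i , j) = h i , h j
    power : ∀ p α β → (p ^ sum (α ++ β)) n ≡ ⨁ n (λ i j → (p ^ sum α) i * (p ^ sum β) j)
    power p α β = trans (cong (λ k → (p ^ k) n) (sum-++ α β)) (^-+ p (sum α) (sum β) n)
    list : ∀ (t : Λ → Λ → ℚ) → ∑ (map hh (antidiagonal n)) (uncurry t) ≡ ⨁ n (λ i j → t (h i) (h j))
    list t = trans (∑-map hh (antidiagonal n) (uncurry t)) (∑-antidiagonal n (λ i j → t (h i) (h j)))
  splitting (add {F} {G} p p′) = record
    { terms   = D.terms ++ E.terms
    ; split   = λ α β → trans (cong₂ _+_ (D.split α β) (E.split α β))
        (sym (∑-++ D.terms E.terms (λ (A , B) → coeff A α * coeff B β)))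
    ; split-U = λ α β → trans (U-+ F G (α ++ β)) (trans
        (cong₂ _+_ (D.split-U α β) (E.split-U α β))
        (sym (∑-++ D.terms E.terms (λ (A , B) → coeff (U A) α * coeff (U B) β))))
    }
    where
    module D = Splitting (splitting p)
    module E = Splitting (splitting p′)
  splitting (scale q {F} p) = record
    { terms   = map times D.terms
    ; split   = λ α β → trans (cong (q *_) (D.split α β))
        (scaled (λ A B → coeff A α * coeff B β) (λ A B → ℚ.*-assoc q (coeff A α) (coeff B β)))
    ; split-U = λ α β → trans (•-homo q F (α ++ β)) (trans (cong (q *_) (D.split-U α β))
        (scaled (λ A B → coeff (U A) α * coeff (U B) β) (λ A B → trans
          (cong (_* coeff (U B) β) (•-homo q A α)) (ℚ.*-assoc q (coeff (U A) α) (coeff (U B) β)))))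
    }
    where
    module D = Splitting (splitting p)
    times : Λ × Λ → Λ × Λ
    times (A , B) = q • A , B
    scaled : ∀ (t : Λ → Λ → ℚ) → (∀ A B → t (q • A) B ≡ q * t A B) →
             q * ∑ D.terms (uncurry t) ≡ ∑ (map times D.terms) (uncurry t)
    scaled t e = trans (∑-*ˡ D.terms q (uncurry t)) (sym (trans
      (∑-map times D.terms (uncurry t)) (∑-cong D.terms (λ (A , B) → e A B))))
  splitting (mul {F} {G} p p′) = record
    { terms   = cartesianProductWith times D.terms E.terms
    ; split   = λ α β → trans
        (⊛-++ (coeff F) (coeff G) D.terms E.terms
          (coeff ∘ proj₁) (coeff ∘ proj₂) (coeff ∘ proj₁) (coeff ∘ proj₂) D.split E.split α β)
        (sym (∑-× times D.terms E.terms (λ (A , B) → coeff A α * coeff B β)))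
    ; split-U = λ α β → trans (U-* F G (α ++ β)) (trans
        (⊛-++ (coeff (U F)) (coeff (U G)) D.terms E.terms
          (coeff ∘ U ∘ proj₁) (coeff ∘ U ∘ proj₂) (coeff ∘ U ∘ proj₁) (coeff ∘ U ∘ proj₂)
          D.split-U E.split-U α β)
        (sym (trans (∑-× times D.terms E.terms (λ (A , B) → coeff (U A) α * coeff (U B) β))
          (∑-cong D.terms (λ (A , B) → ∑-cong E.terms (λ (A′ , B′) →
            cong₂ _*_ (U-* A A′ α) (U-* B B′ β)))))))
    }
    where
    module D = Splitting (splitting p)
    module E = Splitting (splitting p′)
    times : Λ × Λ → Λ × Λ → Λ × Λ
    times (A , B) (A′ , B′) = A *Λ A′ , B *Λ B′
  splitting (resp {F} {G} F≈G p) = record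
    { terms   = D.terms
    ; split   = λ α β → trans (sym (F≈G (α ++ β))) (D.split α β)
    ; split-U = λ α β → trans (sym (U-cong {F} {G} F≈G (α ++ β))) (D.split-U α β)
    }
    where module D = Splitting (splitting p)

  -- U ⊗ U is well defined: equal sums of products have equal images.  U is applied
  -- first to the right factors and then to the left ones.
  U⊗U-cong : ∀ {A B : Set} (xs : List A) (ys : List B)
    (q : A → ℚ) (F F′ : A → Λ) (q′ : B → ℚ) (G G′ : B → Λ) →
    (∀ α β → ∑ xs (λ x → q x * (coeff (F x) α * coeff (F′ x) β)) ≡
             ∑ ys (λ y → q′ y * (coeff (G y) α * coeff (G′ y) β))) →
    ∀ α β → ∑ xs (λ x → q x * (coeff (U (F x)) α * coeff (U (F′ x)) β)) ≡
            ∑ ys (λ y → q′ y * (coeff (U (G y)) α * coeff (U (G′ y)) β))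
  U⊗U-cong xs ys q F F′ q′ G G′ eq α β = begin
    ∑ xs (λ x → q x * (coeff (U (F x)) α * coeff (U (F′ x)) β))
      ≡⟨ left xs q F F′ α β ⟩
    coeff (U (leftΛ xs q F F′ β)) α
      ≡⟨ U-cong {leftΛ xs q F F′ β} {leftΛ ys q′ G G′ β} (λ γ → begin
           coeff (leftΛ xs q F F′ β) γ
             ≡⟨ right xs q F F′ γ β ⟩
           coeff (U (rightΛ xs q F F′ γ)) β
             ≡⟨ U-cong {rightΛ xs q F F′ γ} {rightΛ ys q′ G G′ γ} (λ δ → begin
                  coeff (rightΛ xs q F F′ γ) δ
                    ≡⟨ plain xs q F F′ γ δ ⟩
                  ∑ xs (λ x → q x * (coeff (F x) γ * coeff (F′ x) δ))
                    ≡⟨ eq γ δ ⟩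
                  ∑ ys (λ y → q′ y * (coeff (G y) γ * coeff (G′ y) δ))
                    ≡⟨ plain ys q′ G G′ γ δ ⟨
                  coeff (rightΛ ys q′ G G′ γ) δ ∎) β ⟩
           coeff (U (rightΛ ys q′ G G′ γ)) β
             ≡⟨ right ys q′ G G′ γ β ⟨
           coeff (leftΛ ys q′ G G′ β) γ ∎) α ⟩
    coeff (U (leftΛ ys q′ G G′ β)) α
      ≡⟨ left ys q′ G G′ α β ⟨
    ∑ ys (λ y → q′ y * (coeff (U (G y)) α * coeff (U (G′ y)) β)) ∎
    where
    open ≡-Reasoning
    module _ {A : Set} (xs : List A) (q : A → ℚ) (F F′ : A → Λ) where
      -- The sum with the variables X′ evaluated after applying U, and the one with the
      -- variables X evaluated before applying U.
      leftΛ rightΛ : List ℕ → Λ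
      leftΛ  β = ∑Λ xs (λ x → (q x * coeff (U (F′ x)) β) • F x)
      rightΛ α = ∑Λ xs (λ x → (q x * coeff (F x) α) • F′ x)
      swapʳ : ∀ a b c → a * (b * c) ≡ (a * c) * b
      swapʳ = solve 3 (λ a b c → a :* (b :* c) := (a :* c) :* b) refl
        where open +-*-Solver
      left : ∀ α β → ∑ xs (λ x → q x * (coeff (U (F x)) α * coeff (U (F′ x)) β)) ≡
                     coeff (U (leftΛ β)) α
      left α β = trans
        (∑-cong xs (λ x → swapʳ (q x) (coeff (U (F x)) α) (coeff (U (F′ x)) β)))
        (sym (U-∑ xs (λ x → q x * coeff (U (F′ x)) β) F α))
      right : ∀ α β → coeff (leftΛ β) α ≡ coeff (U (rightΛ α)) β
      right α β = trans
        (∑Λ-coeff xs (λ x → (q x * coeff (U (F′ x)) β) • F x) α)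
        (trans (∑-cong xs (λ x → trans (ℚ.*-assoc (q x) _ _) (swapʳ (q x) (coeff (U (F′ x)) β) (coeff (F x) α))))
          (sym (U-∑ xs (λ x → q x * coeff (F x) α) F′ β)))
      plain : ∀ α β → coeff (rightΛ α) β ≡ ∑ xs (λ x → q x * (coeff (F x) α * coeff (F′ x) β))
      plain α β = trans
        (∑Λ-coeff xs (λ x → (q x * coeff (F x) α) • F′ x) β)
        (∑-cong xs (λ x → ℚ.*-assoc (q x) (coeff (F x) α) (coeff (F′ x) β)))

-- The image of the Schur basis under U_f

proposition1p8 :
    (f g : DeltaSeries) → IsCompositionalInverse f g →
    (U_f U_g : Λ → Λ) → IsUmbralOperator f U_f → IsUmbralOperator g U_g →
    (c : Partition → Partition → Partition → ℚ) → IsLittlewoodRichardson c →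
    IsBasis (P U_f U_g) × IsLRType c (λ p → coeff (P U_f U_g p))
proposition1p8 f g (f∘g , g∘f) U_f U_g umbral-f umbral-g c lr =
  record { spanning = spanning ; independent = independent } , lr-type
  where
  open ≡-Reasoning
  module Uf = AlgebraHomomorphism (IsUmbralOperator.isAlgebraHomomorphism umbral-f)
  module Ug = AlgebraHomomorphism (IsUmbralOperator.isAlgebraHomomorphism umbral-g)

  U_g∘U_f : ∀ F → U_g (U_f F) ≈ F
  U_g∘U_f = umbral-inverse umbral-f umbral-g g∘f

  U_f∘U_g : ∀ F → U_f (U_g F) ≈ F
  U_f∘U_g = umbral-inverse umbral-g umbral-f f∘g

  -- The analogue of 𝒞s for the conjugated operators.
  Cᶠs : List ℕ → Λ
  Cᶠs = foldr (λ m → Cᶠ U_f U_g (ℤ.+ m)) 1Λ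

  -- Each U_g cancels the U_f to its right.
  Cᶠs-𝒞s : ∀ cs → Cᶠs cs ≈ U_f (𝒞s cs)
  Cᶠs-𝒞s []       α = sym (Uf.U-1 α)
  Cᶠs-𝒞s (m ∷ cs) α = Uf.U-cong {𝒞 m (U_g (Cᶠs cs))} {𝒞 m (𝒞s cs)}
    (𝒞-cong m {U_g (Cᶠs cs)} {𝒞s cs} (λ β → trans
      (Ug.U-cong {Cᶠs cs} {U_f (𝒞s cs)} (Cᶠs-𝒞s cs) β) (U_g∘U_f (𝒞s cs) β))) α

  -- P_λ is the image of the Schur function s_λ under U_f.
  P-schur : ∀ p → P U_f U_g p ≈ U_f (schur p)
  P-schur p = Cᶠs-𝒞s (columns (parts p))

  spanning : ∀ F → ∃[ L ] F ≈ ∑Λ {ℚ × Partition} L (λ (q , μ) → q • P U_f U_g μ)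
  spanning F with L , eq ← schur-spanning (U_g F) = L , λ α → begin
    coeff F α
      ≡⟨ U_f∘U_g F α ⟨
    coeff (U_f (U_g F)) α
      ≡⟨ Uf.U-cong {U_g F} {∑Λ L (λ (q , μ) → q • schur μ)} eq α ⟩
    coeff (U_f (∑Λ L (λ (q , μ) → q • schur μ))) α
      ≡⟨ Uf.U-∑ L proj₁ (schur ∘ proj₂) α ⟩
    ∑ L (λ (q , μ) → q * coeff (U_f (schur μ)) α)
      ≡⟨ ∑-cong L (λ (q , μ) → cong (q *_) (P-schur μ α)) ⟨
    ∑ L (λ (q , μ) → q * coeff (P U_f U_g μ) α)
      ≡⟨ ∑Λ-coeff L (λ (q , μ) → q • P U_f U_g μ) α ⟨
    coeff (∑Λ L (λ (q , μ) → q • P U_f U_g μ)) α ∎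

  independent : ∀ (L : List Partition) (a : Partition → ℚ) → Unique L →
                ∑Λ L (λ μ → a μ • P U_f U_g μ) ≈ 0Λ → ∀ {μ} → μ ∈ L → a μ ≡ 0ℚ
  independent L a u eq = schur-independent L a u (λ α → begin
    coeff (∑Λ L (λ μ → a μ • schur μ)) α
      ≡⟨ ∑Λ-coeff L (λ μ → a μ • schur μ) α ⟩
    ∑ L (λ μ → a μ * coeff (schur μ) α)
      ≡⟨ ∑-cong L (λ μ → cong (a μ *_) (trans
           (Ug.U-cong {P U_f U_g μ} {U_f (schur μ)} (P-schur μ) α) (U_g∘U_f (schur μ) α))) ⟨
    ∑ L (λ μ → a μ * coeff (U_g (P U_f U_g μ)) α)
      ≡⟨ Ug.U-∑ L a (P U_f U_g) α ⟨
    coeff (U_g (∑Λ L (λ μ → a μ • P U_f U_g μ))) α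
      ≡⟨ Ug.U-cong {∑Λ L (λ μ → a μ • P U_f U_g μ)} {0Λ} eq α ⟩
    coeff (U_g 0Λ) α
      ≡⟨ Ug.U-0 α ⟩
    0ℚ ∎)

  -- A splitting of s_λ and its Littlewood-Richardson expansion agree, hence so do their
  -- images under U_f ⊗ U_f.
  lr-type : IsLRType c (λ p → coeff (P U_f U_g p))
  lr-type p with L , unique , support , expansion ← lr p = L , unique , support , λ α β → begin
    coeff (P U_f U_g p) (α ++ β)
      ≡⟨ P-schur p (α ++ β) ⟩
    coeff (U_f (schur p)) (α ++ β)
      ≡⟨ split-U α β ⟩
    ∑ terms (λ (A , B) → coeff (U_f A) α * coeff (U_f B) β)
      ≡⟨ ∑-cong terms (λ (A , B) → ℚ.*-identityˡ (coeff (U_f A) α * coeff (U_f B) β)) ⟨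
    ∑ terms (λ (A , B) → 1ℚ * (coeff (U_f A) α * coeff (U_f B) β))
      ≡⟨ U⊗U-cong umbral-f terms L (λ _ → 1ℚ) proj₁ proj₂
           (λ (μ , ν) → c p μ ν) (schur ∘ proj₁) (schur ∘ proj₂) (λ γ δ → begin
             ∑ terms (λ (A , B) → 1ℚ * (coeff A γ * coeff B δ))
               ≡⟨ ∑-cong terms (λ (A , B) → ℚ.*-identityˡ (coeff A γ * coeff B δ)) ⟩
             ∑ terms (λ (A , B) → coeff A γ * coeff B δ)
               ≡⟨ split γ δ ⟨
             coeff (schur p) (γ ++ δ)
               ≡⟨ schur-s p (γ ++ δ) ⟩
             s p (γ ++ δ)
               ≡⟨ expansion γ δ ⟩
             ∑ L (λ (μ , ν) → c p μ ν * (s μ γ * s ν δ))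
               ≡⟨ ∑-cong L (λ (μ , ν) → cong (c p μ ν *_)
                    (cong₂ _*_ (schur-s μ γ) (schur-s ν δ))) ⟨
             ∑ L (λ (μ , ν) → c p μ ν * (coeff (schur μ) γ * coeff (schur ν) δ)) ∎) α β ⟩
    ∑ L (λ (μ , ν) → c p μ ν * (coeff (U_f (schur μ)) α * coeff (U_f (schur ν)) β))
      ≡⟨ ∑-cong L (λ (μ , ν) → cong (c p μ ν *_)
           (cong₂ _*_ (P-schur μ α) (P-schur ν β))) ⟨
    ∑ L (λ (μ , ν) → c p μ ν * (coeff (P U_f U_g μ) α * coeff (P U_f U_g ν) β)) ∎
    where open Splitting (splitting umbral-f (polynomial (schur p)))
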